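{- Let $S$ be the set of positive integers congruent modulo $72$ to one of $\pm 1, \pm 3, \pm 5, \pm 7, \pm 8, \pm 9, \pm 10, \pm 11, \pm 12, \pm 13, \pm 14, \pm 16, \pm 17, \pm 18, \pm 19, \pm 23, \pm 25, \pm 27, \pm 29, \pm 31, \pm 32, \pm 33, \pm 34, \pm 35$, and let $T$ be the set of positive integers congruent modulo $72$ to one of $\pm 1, \pm 2, \pm 5, \pm 7, \pm 8, \pm 9, \pm 11, \pm 12, \pm 13, \pm 15, \pm 16, \pm 17, \pm 18, \pm 19, \pm 21, \pm 22, \pm 23, \pm 25, \pm 26, \pm 27, \pm 29, \pm 31, \pm 32, \pm 35$. Then $p(S,n)=p(T,n-1)$ for all integers $n\geq 1$.
   Context: For a set $S$ of positive integers and an integer $n\ge 0$, $p(S,n)$ denotes the number of partitions of $n$ into parts belonging to $S$ (so $p(S,0)=1$). -}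

module Defs where

open import Data.Nat using (ℕ; zero; suc; _+_; _∸_; _≤ᵇ_; _%_; _≡ᵇ_)
open import Data.Bool using (Bool; true; false; _∧_; _∨_; if_then_else_)
open import Data.List using (List; []; _∷_; _++_; map; length; filter; concatMap; upTo)
open import Data.Bool.ListAction using (any; all)
open import Data.List.Relation.Unary.All using (All)
open import Relation.Binary.PropositionalEquality using (_≡_)
open import Relation.Nullary.Decidable using (Dec)
open import Data.Bool using (T)

-- allParts f k n: all partitions of n into parts ≤ k, as non-increasing lists
-- (each partition listed exactly once). f is fuel (≥ n suffices).
allParts : ℕ → ℕ → ℕ → List (List ℕ)
allParts _        _       zero    = [] ∷ []
allParts zero     _       (suc _) = []
allParts (suc f)  k       n@(suc _) =
  concatMap (λ j → map (suc j ∷_) (allParts f (suc j) (n ∸ suc j)))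
            (filter (λ j → T? ((suc j ≤ᵇ k) ∧ (suc j ≤ᵇ n))) (upTo n))
  where
    T? : (b : Bool) → Dec (T b)
    T? = Data.Bool.T?

partitions : ℕ → List (List ℕ)
partitions n = allParts n n n

p : (ℕ → Bool) → ℕ → ℕ
p S n = length (filter (λ λs → Data.Bool.T? (all S λs)) (partitions n))

resMod72 : List ℕ → ℕ → Bool
resMod72 rs m = any (λ r → (m % 72) ≡ᵇ r) rs

pm : List ℕ → List ℕ
pm rs = rs ++ map (λ r → 72 ∸ r) rs

S : ℕ → Bool
S zero = false
S m@(suc _) = resMod72 (pm (1 ∷ 3 ∷ 5 ∷ 7 ∷ 8 ∷ 9 ∷ 10 ∷ 11 ∷ 12 ∷ 13 ∷ 14 ∷ 16 ∷ 17 ∷ 18 ∷ 19 ∷ 23 ∷ 25 ∷ 27 ∷ 29 ∷ 31 ∷ 32 ∷ 33 ∷ 34 ∷ 35 ∷ [])) m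

T' : ℕ → Bool
T' zero = false
T' m@(suc _) = resMod72 (pm (1 ∷ 2 ∷ 5 ∷ 7 ∷ 8 ∷ 9 ∷ 11 ∷ 12 ∷ 13 ∷ 15 ∷ 16 ∷ 17 ∷ 18 ∷ 19 ∷ 21 ∷ 22 ∷ 23 ∷ 25 ∷ 26 ∷ 27 ∷ 29 ∷ 31 ∷ 32 ∷ 35 ∷ [])) m

_ : p (λ _ → true) 5 ≡ 7
_ = Relation.Binary.PropositionalEquality.refl
_ : p (λ _ → true) 10 ≡ 42
_ = Relation.Binary.PropositionalEquality.refl
_ : p (λ m → m ≡ᵇ 2) 6 ≡ 1
_ = Relation.Binary.PropositionalEquality.refl
_ : p S 20 ≡ p T' 19
_ = Relation.Binary.PropositionalEquality.refl

{-# OPTIONS --safe #-}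
module Submission where

open import Defs hiding (p)
open import Data.Nat using (ℕ; suc)
open import Relation.Binary.PropositionalEquality using (_≡_)
open import Algebra.Bundles using (CommutativeMonoid; CommutativeRing; RawRing)
open import Algebra.Solver.Ring.AlmostCommutativeRing using (fromCommutativeRing; _-Raw-AlmostCommutative⟶_)
open import Data.Bool using (Bool; true; false; if_then_else_; _∧_; T?)
open import Data.Bool.ListAction using (all)
open import Data.Integer using (ℤ; +_; -[1+_]; ∣_∣)
open import Data.List using (List; []; _∷_; _++_; map; filter; filterᵇ; length; concatMap; applyUpTo; upTo)
open import Data.List.Properties using (filter-++; length-++)
open import Data.Maybe.Base using (Maybe; just; nothing)
open import Data.Nat using (zero; _≤_; _<_; z≤n; s≤s)
open import Data.Product using (_×_; _,_; proj₁)
open import Function using (_∘_; _$_)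
open import Level using (_⊔_)
open import Relation.Nullary using (yes; no)
import Algebra.Properties.AbelianGroup
import Algebra.Properties.CommutativeSemigroup
import Algebra.Properties.CommutativeSemiring.Exp
import Algebra.Properties.Ring
import Algebra.Properties.Semiring.Mult
import Algebra.Solver.Ring
import Algebra.Solver.Ring.NaturalCoefficients.Default
import Data.Integer as ℤ
import Data.Integer.Properties as ℤ
import Data.Integer.Solver
import Data.Nat as ℕ
import Data.Nat.DivMod as ℕ
import Data.Nat.Properties as ℕ
import Data.Nat.Solver
import Relation.Binary.PropositionalEquality as ≡
import Relation.Binary.Reasoning.Setoid

open Data.Integer.Solver.+-*-Solver using () renaming
  (solve to solveℤ; con to conℤ; _:+_ to _⊕_; _:*_ to _⊗_; :-_ to ⊖_; _:=_ to _⊜_)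
module ℕS = Data.Nat.Solver.+-*-Solver

-- Put G(x) = Σ (-1)ⁿ x^(6n²-5n) and H(x) = Σ (-1)ⁿ x^(6n²-n).  By the Jacobi
-- triple product, and after multiplication by a common infinite product, the
-- claim becomes a product formula for D = q² G(q²) H(q³) - q³ H(q²) G(q³).  The
-- combinations A = H + x G and B = H - x G are theta functions with
-- A(x) = φ(x) / (-x;x²)∞ and B(x) = φ(x³) / (-x;x²)∞, where φ(x) = Σ x^(n²), so
-- that 2D = A(q²) B(q³) - B(q²) A(q³) is a multiple of
-- φ(q²) φ(q⁹) - φ(q³) φ(q⁶).  Since 3 is a norm in ℤ[√-2], φ(q³) φ(q⁶) is a sum
-- of q^(X²+2Y²) over the lattice X ≡ Y mod 3, while φ(q⁹) φ(q²) runs over X ≡ 0;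
-- the difference factors as 2 Σ_{Y≡1} q^(2Y²) · Σ_X ω^X q^(X²) with ω a cube root
-- of unity, and both factors are again triple products.
--
-- Everything takes place in power series over ℤ[ω] modulo q^N: there q is
-- nilpotent, so infinite sums and products are finite ones.

-- With `C_S` and `C_T` the generating functions of the two counts, the claim reads C_S - q C_T = 1.
-- The modulus 72 is the least common multiple of 24 and 36, the bases of the products for G and H
-- at q² and q³. The exponents of these products are what separates `S` from `T'`: G(q²) H(q³)
-- carries ±2, ±15, ±21, ±22, ±26, missing from `S`, and H(q²) G(q³) carries ±3, ±10, ±14, ±33, ±34,
-- missing from `T'`. Hence one multiplier serves both, and the product formula for D becomes q² C_S
-- - q³ C_T = q².
--
-- Truncation creates zero divisors: 1 - x with x nilpotent can be cancelled, q cannot. Products are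
-- therefore moved across equations instead of being divided by, and the last ring identity still
-- carries the factor 2q². The q² goes by reading coefficients two degrees higher, the 2 by an
-- argument on natural numbers.
--
-- Signed factors (-x;p)∞ do not compare with products over residue classes. Each is paired with
-- (x;p)∞ to form (x²;p²)∞; after that only a finite multiset identity modulo 72 is left.

-- Finite sums and products in a commutative monoid

module BigOp {c ℓ} (M : CommutativeMonoid c ℓ) where
  open CommutativeMonoid M
  open Algebra.Properties.CommutativeSemigroup commutativeSemigroup using (interchange)
  open Relation.Binary.Reasoning.Setoid setoid

  ⨁ : ℕ → (ℕ → Carrier) → Carrier
  ⨁ zero    f = ε
  ⨁ (suc n) f = f 0 ∙ ⨁ n (f ∘ suc)

  ⨁-cong : ∀ n {f g} → (∀ i → f i ≈ g i) → ⨁ n f ≈ ⨁ n g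
  ⨁-cong zero    f≈g = refl
  ⨁-cong (suc n) f≈g = ∙-cong (f≈g 0) (⨁-cong n (f≈g ∘ suc))

  ⨁-ε : ∀ n {f} → (∀ i → f i ≈ ε) → ⨁ n f ≈ ε
  ⨁-ε zero    f≈ε = refl
  ⨁-ε (suc n) f≈ε = trans (∙-cong (f≈ε 0) (⨁-ε n (f≈ε ∘ suc))) (identityˡ ε)

  ⨁-∙ : ∀ n f g → ⨁ n (λ i → f i ∙ g i) ≈ ⨁ n f ∙ ⨁ n g
  ⨁-∙ zero    f g = sym (identityˡ ε)
  ⨁-∙ (suc n) f g = trans (∙-congˡ (⨁-∙ n (f ∘ suc) (g ∘ suc))) (interchange _ _ _ _)

  ⨁-swap : ∀ m n (f : ℕ → ℕ → Carrier) →
           ⨁ m (λ i → ⨁ n (f i)) ≈ ⨁ n (λ j → ⨁ m (λ i → f i j))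
  ⨁-swap zero    n f = sym (⨁-ε n (λ _ → refl))
  ⨁-swap (suc m) n f = trans (∙-congˡ (⨁-swap m n (f ∘ suc))) (sym (⨁-∙ n _ _))

  ⨁-+ : ∀ m n f → ⨁ (m ℕ.+ n) f ≈ ⨁ m f ∙ ⨁ n (λ i → f (m ℕ.+ i))
  ⨁-+ zero    n f = sym (identityˡ _)
  ⨁-+ (suc m) n f = trans (∙-congˡ (⨁-+ m n (f ∘ suc))) (sym (assoc _ _ _))

  ⨁-last : ∀ n f → ⨁ (suc n) f ≈ ⨁ n f ∙ f n
  ⨁-last zero    f = comm _ _
  ⨁-last (suc n) f = trans (∙-congˡ (⨁-last n (f ∘ suc))) (sym (assoc _ _ _))

  ⨁-blocks : ∀ n d f → ⨁ (n ℕ.* d) f ≈ ⨁ d (λ i → ⨁ n (λ k → f (k ℕ.* d ℕ.+ i)))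
  ⨁-blocks zero    d f = sym (⨁-ε d (λ _ → refl))
  ⨁-blocks (suc n) d f = begin
    ⨁ (d ℕ.+ n ℕ.* d) f
      ≈⟨ ⨁-+ d (n ℕ.* d) f ⟩
    ⨁ d f ∙ ⨁ (n ℕ.* d) (λ i → f (d ℕ.+ i))
      ≈⟨ ∙-congˡ (⨁-blocks n d (λ i → f (d ℕ.+ i))) ⟩
    ⨁ d f ∙ ⨁ d (λ i → ⨁ n (λ k → f (d ℕ.+ (k ℕ.* d ℕ.+ i))))
      ≈⟨ ⨁-∙ d _ _ ⟨
    ⨁ d (λ i → f i ∙ ⨁ n (λ k → f (d ℕ.+ (k ℕ.* d ℕ.+ i))))
      ≈⟨ ⨁-cong d (λ i → ∙-congˡ (⨁-cong n (λ k →
           reflexive (≡.cong f (≡.sym (ℕ.+-assoc d (k ℕ.* d) i)))))) ⟩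
    ⨁ d (λ i → ⨁ (suc n) (λ k → f (k ℕ.* d ℕ.+ i))) ∎

-- Ring normalisation over an abstract commutative ring needs coefficients in
-- which 1 - 1 = 0 is decidable; a pair (m , n) stands for the integer m - n, kept
-- reduced so that equal normal forms are syntactically equal.
module IntegerSolver {c ℓ} (R : CommutativeRing c ℓ) where
  open CommutativeRing R
  open Algebra.Properties.Ring ring using (-‿distribˡ-*; -‿distribʳ-*)
  open Algebra.Properties.AbelianGroup +-abelianGroup using (⁻¹-involutive; ⁻¹-∙-comm; ε⁻¹≈ε)
  open Algebra.Properties.Semiring.Mult semiring using () renaming (_×_ to _·_; ×-homo-+ to ·-homo-+; ×1-homo-* to ·1-homo-*; ×-congˡ to ·-congˡ)
  open Relation.Binary.Reasoning.Setoid setoid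
  private
    module N = Algebra.Solver.Ring.NaturalCoefficients.Default commutativeSemiring

    _⊞_ _⊠_ : ℕ × ℕ → ℕ × ℕ → ℕ × ℕ
    (a , b) ⊞ (c , d) = a ℕ.+ c , b ℕ.+ d
    (a , b) ⊠ (c , d) = a ℕ.* c ℕ.+ b ℕ.* d , a ℕ.* d ℕ.+ b ℕ.* c

    ⊟_ reduce : ℕ × ℕ → ℕ × ℕ
    ⊟ (a , b) = b , a
    reduce (a , b) = a ℕ.∸ b , b ℕ.∸ a

    coefficients : RawRing _ _
    coefficients = record
      { Carrier = ℕ × ℕ
      ; _≈_     = _≡_
      ; _+_     = λ x y → reduce (x ⊞ y)
      ; _*_     = λ x y → reduce (x ⊠ y)
      ; -_      = ⊟_
      ; 0#      = 0 , 0
      ; 1#      = 1 , 0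
      }

    ⟪_⟫ : ℕ × ℕ → Carrier
    ⟪ a , b ⟫ = a · 1# - b · 1#

    ⟪⟫-+ : ∀ x y → ⟪ x ⊞ y ⟫ ≈ ⟪ x ⟫ + ⟪ y ⟫
    ⟪⟫-+ (a , b) (c , d) = begin
      (a ℕ.+ c) · 1# - (b ℕ.+ d) · 1#
        ≈⟨ +-cong (·-homo-+ 1# a c) (-‿cong (·-homo-+ 1# b d)) ⟩
      (a · 1# + c · 1#) - (b · 1# + d · 1#)
        ≈⟨ +-congˡ (⁻¹-∙-comm _ _) ⟨
      (a · 1# + c · 1#) + (- (b · 1#) - d · 1#)
        ≈⟨ N.solve 4 (λ a c b d → ((a N.:+ c) N.:+ (b N.:+ d)) N.:= ((a N.:+ b) N.:+ (c N.:+ d))) refl _ _ _ _ ⟩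
      ⟪ a , b ⟫ + ⟪ c , d ⟫ ∎

    ⟪⟫-* : ∀ x y → ⟪ x ⊠ y ⟫ ≈ ⟪ x ⟫ * ⟪ y ⟫
    ⟪⟫-* (a , b) (c , d) = begin
      (a ℕ.* c ℕ.+ b ℕ.* d) · 1# - (a ℕ.* d ℕ.+ b ℕ.* c) · 1#
        ≈⟨ +-cong (·*+ a c b d) (-‿cong (·*+ a d b c)) ⟩
      (A * C + B * D) - (A * D + B * C)
        ≈⟨ +-cong (+-congˡ (sym neg*neg)) (sym (⁻¹-∙-comm _ _)) ⟩
      (A * C + (- B) * (- D)) + (- (A * D) + - (B * C))
        ≈⟨ +-congˡ (+-cong (-‿distribʳ-* A D) (-‿distribˡ-* B C)) ⟩
      (A * C + (- B) * (- D)) + (A * (- D) + (- B) * C)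
        ≈⟨ N.solve 4 (λ a c b d → ((a N.:* c N.:+ b N.:* d) N.:+ (a N.:* d N.:+ b N.:* c))
                                   N.:= ((a N.:+ b) N.:* (c N.:+ d))) refl A C (- B) (- D) ⟩
      (A - B) * (C - D) ∎
      where
      A = a · 1#
      B = b · 1#
      C = c · 1#
      D = d · 1#
      neg*neg : (- B) * (- D) ≈ B * D
      neg*neg = trans (sym (-‿distribˡ-* B (- D)))
                (trans (-‿cong (sym (-‿distribʳ-* B D))) (⁻¹-involutive _))
      ·*+ : ∀ a c b d → (a ℕ.* c ℕ.+ b ℕ.* d) · 1# ≈ (a · 1#) * (c · 1#) + (b · 1#) * (d · 1#)
      ·*+ a c b d = trans (·-homo-+ 1# (a ℕ.* c) (b ℕ.* d)) (+-cong (·1-homo-* a c) (·1-homo-* b d))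

    ⟪⟫-neg : ∀ x → ⟪ ⊟ x ⟫ ≈ - ⟪ x ⟫
    ⟪⟫-neg (a , b) = begin
      b · 1# - a · 1#         ≈⟨ +-comm _ _ ⟩
      - (a · 1#) + b · 1#     ≈⟨ +-congˡ (⁻¹-involutive _) ⟨
      - (a · 1#) - - (b · 1#) ≈⟨ ⁻¹-∙-comm _ _ ⟩
      - ⟪ a , b ⟫             ∎

    sameDifference : ∀ a b c d → a ℕ.+ d ≡ c ℕ.+ b → ⟪ a , b ⟫ ≈ ⟪ c , d ⟫
    sameDifference a b c d eq = begin
      A - B                   ≈⟨ +-identityʳ _ ⟨
      (A - B) + 0#            ≈⟨ +-congˡ (-‿inverseʳ D) ⟨
      (A - B) + (D - D)       ≈⟨ N.solve 4 (λ a b d e → ((a N.:+ b) N.:+ (d N.:+ e)) N.:= ((a N.:+ d) N.:+ (b N.:+ e))) refl A (- B) D (- D) ⟩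
      (A + D) + (- B - D)     ≈⟨ +-congʳ (·-homo-+ 1# a d) ⟨
      (a ℕ.+ d) · 1# + (- B - D) ≈⟨ +-congʳ (·-congˡ {1#} eq) ⟩
      (c ℕ.+ b) · 1# + (- B - D) ≈⟨ +-congʳ (·-homo-+ 1# c b) ⟩
      (C + B) + (- B - D)     ≈⟨ N.solve 4 (λ c b e f → ((c N.:+ b) N.:+ (e N.:+ f)) N.:= ((c N.:+ f) N.:+ (b N.:+ e))) refl C B (- B) (- D) ⟩
      (C - D) + (B - B)       ≈⟨ +-congˡ (-‿inverseʳ B) ⟩
      (C - D) + 0#            ≈⟨ +-identityʳ _ ⟩
      C - D                   ∎
      where
      A = a · 1#
      B = b · 1#
      C = c · 1#
      D = d · 1#

    ∸-balance : ∀ a b → a ℕ.∸ b ℕ.+ b ≡ a ℕ.+ (b ℕ.∸ a)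
    ∸-balance zero    b       = ≡.cong (ℕ._+ b) (ℕ.0∸n≡0 b)
    ∸-balance (suc a) zero    = ≡.refl
    ∸-balance (suc a) (suc b) = ≡.trans (ℕ.+-suc (a ℕ.∸ b) b) (≡.cong suc (∸-balance a b))

    ⟪reduce⟫ : ∀ x → ⟪ reduce x ⟫ ≈ ⟪ x ⟫
    ⟪reduce⟫ (a , b) = sameDifference (a ℕ.∸ b) (b ℕ.∸ a) a b (∸-balance a b)

    -- 0 and 1 are sent to `0#` and `1#` definitionally, so that `:0` and `:1` in a solver call
    -- match the constants of the goal; `⟪_⟫` alone would give sums with zero terms.
    ⟦_⟧ : ℕ × ℕ → Carrier
    ⟦ 0 , 0 ⟧ = 0#
    ⟦ 1 , 0 ⟧ = 1#
    ⟦ x     ⟧ = ⟪ x ⟫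

    ⟦⟧≈⟪⟫ : ∀ x → ⟦ x ⟧ ≈ ⟪ x ⟫
    ⟦⟧≈⟪⟫ (0 , 0)           = sym (-‿inverseʳ 0#)
    ⟦⟧≈⟪⟫ (1 , 0)           = sym (trans (+-cong (+-identityʳ 1#) ε⁻¹≈ε) (+-identityʳ 1#))
    ⟦⟧≈⟪⟫ (0 , suc _)       = refl
    ⟦⟧≈⟪⟫ (1 , suc _)       = refl
    ⟦⟧≈⟪⟫ (suc (suc _) , _) = refl

    homomorphism : coefficients -Raw-AlmostCommutative⟶ fromCommutativeRing R
    homomorphism = record
      { ⟦_⟧    = ⟦_⟧
      ; +-homo = λ x y → trans (⟦⟧≈⟪⟫ (reduce (x ⊞ y))) (trans (⟪reduce⟫ (x ⊞ y)) (trans (⟪⟫-+ x y) (sym (+-cong (⟦⟧≈⟪⟫ x) (⟦⟧≈⟪⟫ y)))))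
      ; *-homo = λ x y → trans (⟦⟧≈⟪⟫ (reduce (x ⊠ y))) (trans (⟪reduce⟫ (x ⊠ y)) (trans (⟪⟫-* x y) (sym (*-cong (⟦⟧≈⟪⟫ x) (⟦⟧≈⟪⟫ y)))))
      ; -‿homo = λ x → trans (⟦⟧≈⟪⟫ (⊟ x)) (trans (⟪⟫-neg x) (sym (-‿cong (⟦⟧≈⟪⟫ x))))
      ; 0-homo = refl
      ; 1-homo = refl
      }

    _≟_ : ∀ x y → Maybe (⟦ x ⟧ ≈ ⟦ y ⟧)
    (a , b) ≟ (c , d) with a ℕ.+ d ℕ.≟ c ℕ.+ b
    ... | yes eq = just (trans (⟦⟧≈⟪⟫ (a , b)) (trans (sameDifference a b c d eq) (sym (⟦⟧≈⟪⟫ (c , d)))))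
    ... | no _   = nothing

  open Algebra.Solver.Ring coefficients (fromCommutativeRing R) homomorphism _≟_ public
    using (Polynomial; con; solve; _:=_; _:+_; _:*_; _:-_; _:^_; :-_)

  :0 :1 : ∀ {n} → Polynomial n
  :0 = con (0 , 0)
  :1 = con (1 , 0)

-- Products with nilpotent base, cancellation, and the Jacobi triple product

module Nilpotent {c ℓ} (R : CommutativeRing c ℓ) (N : ℕ) where
  open CommutativeRing R public
  open Algebra.Properties.CommutativeSemiring.Exp commutativeSemiring public
  open BigOp +-commutativeMonoid public using () renaming
    (⨁ to ∑; ⨁-cong to ∑-cong; ⨁-ε to ∑-zero; ⨁-∙ to ∑-distrib; ⨁-swap to ∑-swap; ⨁-+ to ∑-split; ⨁-last to ∑-last; ⨁-blocks to ∑-blocks)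
  open BigOp *-commutativeMonoid public using () renaming
    (⨁ to ∏; ⨁-cong to ∏-cong; ⨁-ε to ∏-one; ⨁-∙ to ∏-distrib; ⨁-+ to ∏-split; ⨁-last to ∏-last; ⨁-blocks to ∏-blocks)
  open IntegerSolver R public
  open Relation.Binary.Reasoning.Setoid setoid

  ∑-*ˡ : ∀ n x f → x * ∑ n f ≈ ∑ n (λ i → x * f i)
  ∑-*ˡ zero    x f = zeroʳ x
  ∑-*ˡ (suc n) x f = trans (distribˡ x _ _) (+-congˡ (∑-*ˡ n x (f ∘ suc)))

  record Nil (x : Carrier) : Set ℓ where
    constructor mkNil
    field vanishes : x ^ N ≈ 0#
  open Nil

  Nil-*ʳ : ∀ {x} y → Nil x → Nil (x * y)
  Nil-*ʳ {x} y (mkNil x^N≈0) = mkNil $ trans (^-distrib-* x y N) (trans (*-congʳ x^N≈0) (zeroˡ _))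

  Nil-resp : ∀ {x y} → x ≈ y → Nil x → Nil y
  Nil-resp x≈y (mkNil x^N≈0) = mkNil $ trans (^-congˡ N (sym x≈y)) x^N≈0

  Nil-*ˡ : ∀ x {y} → Nil y → Nil (x * y)
  Nil-*ˡ x {y} nil = Nil-resp (*-comm y x) (Nil-*ʳ x nil)

  Nil-neg : ∀ {x} → Nil x → Nil (- x)
  Nil-neg {x} nil = Nil-resp (solve 1 (λ x → (:- (:1)) :* x := :- x) refl x) (Nil-*ˡ (- 1#) nil)

  Nil-≥ : ∀ {x k} → Nil x → N ≤ k → x ^ k ≈ 0#
  Nil-≥ {x} {k} (mkNil x^N≈0) N≤k = begin
    x ^ k                      ≈⟨ ^-congʳ x (≡.sym (ℕ.m+[n∸m]≡n N≤k)) ⟩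
    x ^ (N ℕ.+ (k ℕ.∸ N))      ≈⟨ ^-homo-* x N (k ℕ.∸ N) ⟩
    x ^ N * x ^ (k ℕ.∸ N)      ≈⟨ *-congʳ x^N≈0 ⟩
    0# * x ^ (k ℕ.∸ N)         ≈⟨ zeroˡ _ ⟩
    0#                         ∎

  1-cong : ∀ {x y} → x ≈ y → 1# - x ≈ 1# - y
  1-cong x≈y = +-congˡ (-‿cong x≈y)

  1-0* : ∀ {x} → x ≈ 0# → 1# - x ≈ 1#
  1-0* {x} x≈0 = trans (1-cong x≈0) (solve 0 (:1 :- :0 := :1) refl)

  qp : ℕ → Carrier → Carrier → Carrier
  qp k x p = ∏ k (λ i → 1# - x * p ^ i)

  -- The infinite product (x;p)∞: once p^N = 0, all factors from index N on equal 1.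
  Q : Carrier → Carrier → Carrier
  Q = qp N

  qp-cong : ∀ k {x y p r} → x ≈ y → p ≈ r → qp k x p ≈ qp k y r
  qp-cong k x≈y p≈r = ∏-cong k (λ i → 1-cong (*-cong x≈y (^-congˡ i p≈r)))

  Q-cong : ∀ {x y p r} → x ≈ y → p ≈ r → Q x p ≈ Q y r
  Q-cong = qp-cong N

  qp-peel : ∀ k x p → qp (suc k) x p ≈ (1# - x) * qp k (x * p) p
  qp-peel k x p = *-cong (1-cong (*-identityʳ x))
    (∏-cong k (λ i → 1-cong (sym (*-assoc x p (p ^ i)))))

  qp-zero : ∀ k {x} p → x ≈ 0# → qp k x p ≈ 1#
  qp-zero k p x≈0 = ∏-one k (λ i → 1-0* (trans (*-congʳ x≈0) (zeroˡ _)))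

  qp-stable : ∀ {k} x {p} → Nil p → N ≤ k → qp k x p ≈ Q x p
  qp-stable {k} x {p} nil N≤k = begin
    qp k x p                             ≡⟨ ≡.cong (λ k → qp k x p) (≡.sym (ℕ.m+[n∸m]≡n N≤k)) ⟩
    qp (N ℕ.+ m) x p                     ≈⟨ ∏-split N m _ ⟩
    Q x p * ∏ m (λ i → 1# - x * p ^ (N ℕ.+ i))
      ≈⟨ *-congˡ (∏-one m (λ i → 1-0* (trans (*-congˡ (Nil-≥ nil (ℕ.m≤m+n N i))) (zeroʳ x)))) ⟩
    Q x p * 1#                           ≈⟨ *-identityʳ _ ⟩
    Q x p                                ∎
    where m = k ℕ.∸ N

  Q-peel : ∀ x {p} → Nil p → Q x p ≈ (1# - x) * Q (x * p) p
  Q-peel x {p} nil = trans (sym (qp-stable x nil (ℕ.n≤1+n N))) (qp-peel N x p)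

  Q-zero : ∀ {x} p → x ≈ 0# → Q x p ≈ 1#
  Q-zero = qp-zero N

  -- Factors are grouped by their index modulo d + 1. The product is first lengthened to N(d + 1)
  -- factors, so that each class has exactly the N factors of a full `Q`.
  Q-blocks : ∀ d x {p} → Nil p → Q x p ≈ ∏ (suc d) (λ i → Q (x * p ^ i) (p ^ suc d))
  Q-blocks d x {p} nil = begin
    Q x p
      ≈⟨ qp-stable x nil (ℕ.m≤m*n N (suc d)) ⟨
    qp (N ℕ.* suc d) x p
      ≈⟨ ∏-blocks N (suc d) _ ⟩
    ∏ (suc d) (λ i → ∏ N (λ k → 1# - x * p ^ (k ℕ.* suc d ℕ.+ i)))
      ≈⟨ ∏-cong (suc d) (λ i → ∏-cong N (λ k → 1-cong (exponent i k))) ⟩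
    ∏ (suc d) (λ i → Q (x * p ^ i) (p ^ suc d)) ∎
    where
    exponent : ∀ i k → x * p ^ (k ℕ.* suc d ℕ.+ i) ≈ (x * p ^ i) * (p ^ suc d) ^ k
    exponent i k = begin
      x * p ^ (k ℕ.* suc d ℕ.+ i)
        ≈⟨ *-congˡ (trans (^-congʳ p (≡.trans (ℕ.+-comm (k ℕ.* suc d) i) (≡.cong (i ℕ.+_) (ℕ.*-comm k (suc d))))) (^-homo-* p i (suc d ℕ.* k))) ⟩
      x * (p ^ i * p ^ (suc d ℕ.* k))
        ≈⟨ *-assoc _ _ _ ⟨
      (x * p ^ i) * p ^ (suc d ℕ.* k)
        ≈⟨ *-congˡ (^-assocʳ p (suc d) k) ⟨
      (x * p ^ i) * (p ^ suc d) ^ k ∎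

  Q-square : ∀ x p → Q (- x) p * Q x p ≈ Q (x * x) (p * p)
  Q-square x p = trans (sym (∏-distrib N _ _)) (∏-cong N λ i → begin
    (1# - (- x) * p ^ i) * (1# - x * p ^ i)
      ≈⟨ solve 2 (λ x y → (:1 :- (:- x) :* y) :* (:1 :- x :* y) := :1 :- (x :* x) :* (y :* y)) refl x (p ^ i) ⟩
    1# - (x * x) * (p ^ i * p ^ i)
      ≈⟨ 1-cong (*-congˡ (^-distrib-* p p i)) ⟨
    1# - (x * x) * (p * p) ^ i ∎)

  record Cancellable (x : Carrier) : Set (c ⊔ ℓ) where
    constructor mkCancellable
    field annihilated : ∀ y → x * y ≈ 0# → y ≈ 0#
  open Cancellable

  cancellable-* : ∀ {x y} → Cancellable x → Cancellable y → Cancellable (x * y)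
  cancellable-* {x} {y} cx cy = mkCancellable λ z xyz≈0 → annihilated cy z (annihilated cx (y * z) (trans (sym (*-assoc _ _ _)) xyz≈0))

  -- From (1 - x) y = 0 follows y = x y, hence y = x^N y = 0.
  cancellable-1-nil : ∀ {x} → Nil x → Cancellable (1# - x)
  cancellable-1-nil {x} nil = mkCancellable λ y eq → trans (iterate y eq N) (trans (*-congʳ (vanishes nil)) (zeroˡ y))
    where
    module _ (y : Carrier) (eq : (1# - x) * y ≈ 0#) where
      y≈xy : y ≈ x * y
      y≈xy = begin
        y                        ≈⟨ solve 2 (λ x y → y := (:1 :- x) :* y :+ x :* y) refl x y ⟩
        (1# - x) * y + x * y     ≈⟨ +-congʳ eq ⟩
        0# + x * y               ≈⟨ +-identityˡ _ ⟩
        x * y                    ∎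
      iterate : ∀ k → y ≈ x ^ k * y
      iterate zero    = sym (*-identityˡ y)
      iterate (suc k) = trans y≈xy (trans (*-congˡ (iterate k)) (sym (*-assoc _ _ _)))

  cancellable-Q : ∀ {x} p → Nil x → Cancellable (Q x p)
  cancellable-Q {x} p nil = go N (λ i → x * p ^ i) (λ i → Nil-*ʳ (p ^ i) nil)
    where
    go : ∀ n (f : ℕ → Carrier) → (∀ i → Nil (f i)) → Cancellable (∏ n (λ i → 1# - f i))
    go zero    f nil = mkCancellable λ y eq → trans (sym (*-identityˡ y)) eq
    go (suc n) f nil = cancellable-* (cancellable-1-nil (nil 0)) (go n (λ i → f (suc i)) (λ i → nil (suc i)))

  cancel : ∀ {x} → Cancellable x → ∀ {y z} → x * y ≈ x * z → y ≈ z
  cancel {x} cx {y} {z} eq = begin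
    y              ≈⟨ solve 2 (λ y z → y := (y :- z) :+ z) refl y z ⟩
    (y - z) + z    ≈⟨ +-congʳ (annihilated cx (y - z) (trans (solve 3 (λ x y z → x :* (y :- z) := x :* y :- x :* z) refl x y z)
                        (trans (+-congʳ eq) (-‿inverseʳ _)))) ⟩
    0# + z         ≈⟨ +-identityˡ z ⟩
    z              ∎

  triangle : ℕ → ℕ
  triangle zero    = 0
  triangle (suc i) = triangle i ℕ.+ i

  u : Carrier → Carrier → ℕ → Carrier
  u p x i = x ^ i * p ^ triangle i

  u-cong : ∀ {p r x y} → p ≈ r → x ≈ y → ∀ i → u p x i ≈ u r y i
  u-cong p≈r x≈y i = *-cong (^-congˡ i x≈y) (^-congˡ (triangle i) p≈r)

  u-suc : ∀ p x i → u p x (suc i) ≈ x * p ^ i * u p x i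
  u-suc p x i = trans (*-congˡ (^-homo-* p (triangle i) i))
    (solve 4 (λ x y z w → (x :* y) :* (z :* w) := x :* w :* (y :* z)) refl x (x ^ i) (p ^ triangle i) (p ^ i))

  u-scale : ∀ p x i → u p (x * p) i ≈ p ^ i * u p x i
  u-scale p x i = trans (*-congʳ (^-distrib-* x p i))
    (solve 3 (λ x y z → (x :* y) :* z := y :* (x :* z)) refl (x ^ i) (p ^ i) (p ^ triangle i))

  u-nil : ∀ p {x i} → Nil x → N ≤ i → u p x i ≈ 0#
  u-nil p nil N≤i = trans (*-congʳ (Nil-≥ nil N≤i)) (zeroˡ _)

  -- Each use of the functional equation in `euler-partial` costs one term, and after N uses N + 1
  -- terms must remain. The same margin makes the N lowest entries of `shifted a b W` vanish when b
  -- is nilpotent.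
  W : ℕ
  W = N ℕ.+ suc N

  ∑ℤ : ℕ → (ℤ → Carrier) → Carrier
  ∑ℤ n F = ∑ n (λ i → F (+ i) + F -[1+ i ])

  -- Ramanujan's theta function f(a,b), with j-th term a^(j(j+1)/2) b^(j(j-1)/2). For negative j the
  -- roles of a and b are exchanged, which keeps all exponents natural.
  term : Carrier → Carrier → ℤ → Carrier
  term a b (+ i)    = u (a * b) a i
  term a b -[1+ i ] = u (a * b) b (suc i)

  Θ : Carrier → Carrier → Carrier
  Θ a b = ∑ℤ W (term a b)

  module JacobiTriple (p : Carrier) (p-nil : Nil p) where

    -- Stands for (p;p)∞ / (p;p)_i without a division: `V 0` is (p;p)∞, and `V-suc` strips one
    -- factor.
    V : ℕ → Carrier
    V i = Q (p ^ suc i) p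

    V-suc : ∀ i → V i ≈ (1# - p ^ suc i) * V (suc i)
    V-suc i = trans (Q-peel (p ^ suc i) p-nil) (*-congˡ (Q-cong (*-comm _ p) refl))

    V-one : ∀ {i} → N ≤ i → V i ≈ 1#
    V-one N≤i = Q-zero p (Nil-≥ p-nil (ℕ.m≤n⇒m≤1+n N≤i))

    -- In the second sum V_i = V_{i+1} - p^(i+1) V_{i+1}. The subtracted parts cancel the first sum
    -- from its second term on, and only the last of them is left over.
    telescope : ∀ (s : ℕ → Carrier) L →
      ∑ L (λ i → p ^ i * s i * V i) + ∑ L (λ i → s (suc i) * V i)
        ≈ ∑ (suc L) (λ i → s i * V i) - p ^ L * s L * V L
    telescope s zero = solve 2 (λ s v → :0 :+ :0 := (s :* v :+ :0) :- :1 :* s :* v) refl (s 0) (V 0)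
    telescope s (suc L) = begin
      ∑ (suc L) f + ∑ (suc L) g
        ≈⟨ +-cong (∑-last L f) (∑-last L g) ⟩
      (∑ L f + f L) + (∑ L g + g L)
        ≈⟨ solve 4 (λ a b c d → (a :+ b) :+ (c :+ d) := (a :+ c) :+ (b :+ d)) refl _ _ _ _ ⟩
      (∑ L f + ∑ L g) + (f L + g L)
        ≈⟨ +-cong (telescope s L) (+-congˡ (*-congˡ (V-suc L))) ⟩
      (∑ (suc L) h - p ^ L * s L * V L) + (p ^ L * s L * V L + s (suc L) * ((1# - p ^ suc L) * V (suc L)))
        ≈⟨ solve 5 (λ a b s v x → (a :- b) :+ (b :+ s :* ((:1 :- x) :* v)) := (a :+ s :* v) :- x :* s :* v) refl
             (∑ (suc L) h) (p ^ L * s L * V L) (s (suc L)) (V (suc L)) (p ^ suc L) ⟩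
      (∑ (suc L) h + h (suc L)) - p ^ suc L * s (suc L) * V (suc L)
        ≈⟨ +-congʳ (∑-last (suc L) h) ⟨
      ∑ (suc (suc L)) h - p ^ suc L * s (suc L) * V (suc L) ∎
      where
      f g h : ℕ → Carrier
      f i = p ^ i * s i * V i
      g i = s (suc i) * V i
      h i = s i * V i

    -- The common engine of Euler's expansion and of the triple product: a binomial factor y + x
    -- acts on a `V`-weighted sum by replacing the coefficients t by s. The boundary term of
    -- `telescope` carries p^L = 0.
    multiply : ∀ {L} → N ≤ L → ∀ y x (s t : ℕ → Carrier) →
               (∀ i → y * t i ≈ p ^ i * s i) → (∀ i → x * t i ≈ s (suc i)) →
               (y + x) * ∑ L (λ i → t i * V i) ≈ ∑ (suc L) (λ i → s i * V i)
    multiply {L} N≤L y x s t yt≈ xt≈ = begin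
      (y + x) * ∑ L (λ i → t i * V i)
        ≈⟨ distribʳ _ y x ⟩
      y * ∑ L (λ i → t i * V i) + x * ∑ L (λ i → t i * V i)
        ≈⟨ +-cong (scale y yt≈) (scale x xt≈) ⟩
      ∑ L (λ i → p ^ i * s i * V i) + ∑ L (λ i → s (suc i) * V i)
        ≈⟨ telescope s L ⟩
      ∑ (suc L) (λ i → s i * V i) - p ^ L * s L * V L
        ≈⟨ +-congˡ (-‿cong (trans (*-congʳ (*-congʳ (Nil-≥ p-nil N≤L))) (trans (*-congʳ (zeroˡ _)) (zeroˡ _)))) ⟩
      ∑ (suc L) (λ i → s i * V i) - 0#
        ≈⟨ solve 1 (λ x → x :- :0 := x) refl _ ⟩
      ∑ (suc L) (λ i → s i * V i) ∎
      where
      scale : ∀ z {r : ℕ → Carrier} → (∀ i → z * t i ≈ r i) →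
              z * ∑ L (λ i → t i * V i) ≈ ∑ L (λ i → r i * V i)
      scale z zt≈ = trans (∑-*ˡ L z _) (∑-cong L (λ i → trans (sym (*-assoc _ _ _)) (*-congʳ (zt≈ i))))

    eulerSum : ℕ → Carrier → Carrier
    eulerSum L x = ∑ L (λ i → u p x i * V i)

    eulerSum-cong : ∀ L {x y} → x ≈ y → eulerSum L x ≈ eulerSum L y
    eulerSum-cong L x≈y = ∑-cong L (λ i → *-congʳ (u-cong refl x≈y i))

    -- The weighted series satisfies F(x) = (1 + x) F(xp), by `multiply` with y = 1. Truncated sums
    -- lose one term with each application, hence the different lengths on the two sides.
    euler-partial : ∀ k x → eulerSum (k ℕ.+ suc N) x
                      ≈ qp k (- x) p * eulerSum (suc N) (x * p ^ k)
    euler-partial zero    x = trans (eulerSum-cong (suc N) (sym (*-identityʳ x)))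
                                    (sym (*-identityˡ _))
    euler-partial (suc k) x = begin
      ∑ (suc (k ℕ.+ suc N)) (λ i → u p x i * V i)
        ≈⟨ multiply (ℕ.≤-trans (ℕ.n≤1+n N) (ℕ.m≤n+m (suc N) k)) 1# x (u p x) (u p (x * p))
             (λ i → trans (*-identityˡ _) (u-scale p x i))
             (λ i → trans (*-congˡ (u-scale p x i)) (trans (sym (*-assoc _ _ _)) (sym (u-suc p x i)))) ⟨
      (1# + x) * eulerSum (k ℕ.+ suc N) (x * p)
        ≈⟨ *-congˡ (euler-partial k (x * p)) ⟩
      (1# + x) * (qp k (- (x * p)) p * eulerSum (suc N) ((x * p) * p ^ k))
        ≈⟨ *-assoc _ _ _ ⟨
      (1# + x) * qp k (- (x * p)) p * eulerSum (suc N) ((x * p) * p ^ k)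
        ≈⟨ *-cong (*-cong (solve 1 (λ x → :1 :+ x := :1 :- (:- x)) refl x)
             (qp-cong k (solve 2 (λ x p → :- (x :* p) := (:- x) :* p) refl x p) refl))
             (eulerSum-cong (suc N) (*-assoc x p (p ^ k))) ⟩
      (1# - (- x)) * qp k (- x * p) p * eulerSum (suc N) (x * p ^ suc k)
        ≈⟨ *-congʳ (qp-peel k (- x) p) ⟨
      qp (suc k) (- x) p * eulerSum (suc N) (x * p ^ suc k) ∎

    -- Euler's expansion of (-x;p)∞, multiplied through by (p;p)∞. After N steps the argument x p^N
    -- is 0 and only the constant term survives.
    euler : ∀ x → eulerSum W x ≈ Q (- x) p * V 0
    euler x = trans (euler-partial N x) (*-congˡ (begin
      u p z 0 * V 0 + ∑ N (λ i → u p z (suc i) * V (suc i))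
        ≈⟨ +-cong (*-congʳ (*-identityˡ 1#)) (∑-zero N (λ i → trans (*-congʳ (trans (*-congʳ (trans (*-congʳ z≈0) (zeroˡ _))) (zeroˡ _))) (zeroˡ _))) ⟩
      1# * V 0 + 0#
        ≈⟨ solve 1 (λ v → :1 :* v :+ :0 := v) refl (V 0) ⟩
      V 0 ∎))
      where
      z = x * p ^ N
      z≈0 : z ≈ 0#
      z≈0 = trans (*-congˡ (vanishes p-nil)) (zeroʳ x)

  -- shifted a b n lists the terms of Θ a b from index -n upwards.
  shifted : Carrier → Carrier → ℕ → ℕ → Carrier
  shifted a b zero    i       = u (a * b) a i
  shifted a b (suc n) zero    = u (a * b) b (suc n)
  shifted a b (suc n) (suc i) = shifted a b n i

  -- The hypothesis of `multiply` for the factor 1 + b pⁿ with p = ab: appending this factor moves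
  -- the lowest index from -n to -n-1.
  shifted-suc : ∀ a b n i → b * (a * b) ^ n * shifted a b n i ≈ (a * b) ^ i * shifted a b (suc n) i
  shifted-suc a b zero zero = solve 1 (λ b → b :* :1 :* (:1 :* :1) := :1 :* ((b :* :1) :* :1)) refl b
  shifted-suc a b zero (suc i) = trans (*-congˡ (u-suc (a * b) a i))
    (solve 4 (λ a b p u → b :* :1 :* (a :* p :* u) := (a :* b :* p) :* u) refl a b ((a * b) ^ i) (u (a * b) a i))
  shifted-suc a b (suc n) zero = trans (sym (u-suc (a * b) b (suc n))) (sym (*-identityˡ _))
  shifted-suc a b (suc n) (suc i) = begin
    b * (p * p ^ n) * shifted a b n i   ≈⟨ solve 4 (λ b p q s → b :* (p :* q) :* s := p :* (b :* q :* s)) refl b p (p ^ n) _ ⟩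
    p * (b * p ^ n * shifted a b n i)   ≈⟨ *-congˡ (shifted-suc a b n i) ⟩
    p * (p ^ i * shifted a b (suc n) i) ≈⟨ *-assoc _ _ _ ⟨
    p * p ^ i * shifted a b (suc n) i   ∎
    where
    p : Carrier
    p = a * b

  shifted-low : ∀ a b i m → shifted a b (i ℕ.+ m) i ≈ u (a * b) b m
  shifted-low a b zero    zero    = refl
  shifted-low a b zero    (suc m) = refl
  shifted-low a b (suc i) m       = shifted-low a b i m

  ∑-shifted : ∀ a b n m → ∑ (n ℕ.+ m) (shifted a b n) ≈ ∑ n (λ i → u (a * b) b (suc i)) + ∑ m (u (a * b) a)
  ∑-shifted a b zero    m = sym (+-identityˡ _)
  ∑-shifted a b (suc n) m = begin
    u (a * b) b (suc n) + ∑ (n ℕ.+ m) (shifted a b n)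
      ≈⟨ +-congˡ (∑-shifted a b n m) ⟩
    u (a * b) b (suc n) + (∑ n (λ i → u (a * b) b (suc i)) + ∑ m (u (a * b) a))
      ≈⟨ solve 3 (λ x y z → x :+ (y :+ z) := (y :+ x) :+ z) refl _ _ _ ⟩
    (∑ n (λ i → u (a * b) b (suc i)) + u (a * b) b (suc n)) + ∑ m (u (a * b) a)
      ≈⟨ +-congʳ (∑-last n _) ⟨
    ∑ (suc n) (λ i → u (a * b) b (suc i)) + ∑ m (u (a * b) a) ∎

  N≤W : N ≤ W
  N≤W = ℕ.m≤m+n N (suc N)

  -- Euler's series for (-a;p)∞ is multiplied by the factors 1 + b pⁿ one at a time. Each lowers the
  -- first index by one, so the sum grows bilateral while the weights `V` stay attached to the
  -- positions. From position N on the weights are 1; the earlier positions hold powers of b beyond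
  -- N, hence 0.
  jacobi-triple : ∀ a b → Nil b → Q (a * b) (a * b) * Q (- a) (a * b) * Q (- b) (a * b) ≈ Θ a b
  jacobi-triple a b b-nil = begin
    Q p p * Q (- a) p * Q (- b) p
      ≈⟨ solve 3 (λ x y z → x :* y :* z := z :* (y :* x)) refl _ _ _ ⟩
    Q (- b) p * (Q (- a) p * Q p p)
      ≈⟨ *-cong (sym (qp-stable (- b) p-nil N≤W)) (*-congˡ (Q-cong (sym (*-identityʳ p)) refl)) ⟩
    qp W (- b) p * (Q (- a) p * V 0)
      ≈⟨ *-congˡ (euler a) ⟨
    qp W (- b) p * ∑ W (λ i → u p a i * V i)
      ≈⟨ multiply-b W ⟩
    ∑ (W ℕ.+ W) (λ i → shifted a b W i * V i)
      ≈⟨ ∑-cong (W ℕ.+ W) V-absorbed ⟩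
    ∑ (W ℕ.+ W) (shifted a b W)
      ≈⟨ ∑-shifted a b W W ⟩
    ∑ W (λ i → u p b (suc i)) + ∑ W (u p a)
      ≈⟨ trans (+-comm _ _) (sym (∑-distrib W _ _)) ⟩
    Θ a b ∎
    where
    p : Carrier
    p = a * b
    p-nil : Nil p
    p-nil = Nil-*ˡ a b-nil
    open JacobiTriple p p-nil

    multiply-b : ∀ n → qp n (- b) p * ∑ W (λ i → u p a i * V i) ≈ ∑ (n ℕ.+ W) (λ i → shifted a b n i * V i)
    multiply-b zero    = *-identityˡ _
    multiply-b (suc n) = begin
      qp (suc n) (- b) p * ∑ W (λ i → u p a i * V i)
        ≈⟨ *-congʳ (∏-last n _) ⟩
      qp n (- b) p * (1# - (- b) * p ^ n) * ∑ W (λ i → u p a i * V i)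
        ≈⟨ solve 4 (λ x b p y → x :* (:1 :- (:- b) :* p) :* y := (:1 :+ b :* p) :* (x :* y)) refl _ b (p ^ n) _ ⟩
      (1# + b * p ^ n) * (qp n (- b) p * ∑ W (λ i → u p a i * V i))
        ≈⟨ *-congˡ (multiply-b n) ⟩
      (1# + b * p ^ n) * ∑ (n ℕ.+ W) (λ i → shifted a b n i * V i)
        ≈⟨ *-congʳ (+-comm _ _) ⟩
      (b * p ^ n + 1#) * ∑ (n ℕ.+ W) (λ i → shifted a b n i * V i)
        ≈⟨ multiply (ℕ.≤-trans N≤W (ℕ.m≤n+m W n)) (b * p ^ n) 1# (shifted a b (suc n)) (shifted a b n)
             (shifted-suc a b n) (λ i → *-identityˡ _) ⟩
      ∑ (suc n ℕ.+ W) (λ i → shifted a b (suc n) i * V i) ∎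

    V-absorbed : ∀ i → shifted a b W i * V i ≈ shifted a b W i
    V-absorbed i with N ℕ.≤? i
    ... | yes N≤i = trans (*-congˡ (V-one N≤i)) (*-identityʳ _)
    ... | no  N≰i = trans (*-congʳ low) (trans (zeroˡ _) (sym low))
      where
      i≤N : i ≤ N
      i≤N = ℕ.<⇒≤ (ℕ.≰⇒> N≰i)
      low : shifted a b W i ≈ 0#
      low = begin
        shifted a b W i
          ≡⟨ ≡.cong (λ n → shifted a b n i) (≡.sym (ℕ.m+[n∸m]≡n (ℕ.≤-trans i≤N N≤W))) ⟩
        shifted a b (i ℕ.+ (W ℕ.∸ i)) i
          ≈⟨ shifted-low a b i (W ℕ.∸ i) ⟩
        u p b (W ℕ.∸ i)
          ≈⟨ u-nil p b-nil (ℕ.≤-trans (ℕ.≤-trans (ℕ.n≤1+n N) (ℕ.≤-reflexive (≡.sym (ℕ.m+n∸m≡n N (suc N))))) (ℕ.∸-monoʳ-≤ W i≤N)) ⟩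
        0# ∎

-- Bilateral sums with bounded support: reflection, shift, splitting modulo 3

suc-neg : ∀ n → ℤ.suc -[1+ n ] ≡ ℤ.- (+ n)
suc-neg zero    = ≡.refl
suc-neg (suc n) = ≡.refl

infix 5 3*_+_
3*_+_ : ℤ → ℕ → ℤ
3* k + r = + 3 ℤ.* k ℤ.+ + r

∣shift∣ : ∀ B j y → B ℕ.+ ∣ y ∣ ≤ ∣ j ∣ → B ≤ ∣ j ℤ.+ y ∣
∣shift∣ B j y le = ℕ.+-cancelʳ-≤ (∣ y ∣) B (∣ j ℤ.+ y ∣) (begin
  B ℕ.+ ∣ y ∣                   ≤⟨ le ⟩
  ∣ j ∣                         ≡⟨ ≡.cong ∣_∣ (solveℤ 2 (λ j y → j ⊜ (j ⊕ y) ⊕ (⊖ y)) ≡.refl j y) ⟩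
  ∣ (j ℤ.+ y) ℤ.- y ∣           ≤⟨ ℤ.∣i+j∣≤∣i∣+∣j∣ (j ℤ.+ y) (ℤ.- y) ⟩
  ∣ j ℤ.+ y ∣ ℕ.+ ∣ ℤ.- y ∣     ≡⟨ ≡.cong (∣ j ℤ.+ y ∣ ℕ.+_) (ℤ.∣-i∣≡∣i∣ y) ⟩
  ∣ j ℤ.+ y ∣ ℕ.+ ∣ y ∣         ∎)
  where open ℕ.≤-Reasoning

module BilateralSums {c ℓ} (R : CommutativeRing c ℓ) (N : ℕ) where
  open Nilpotent R N
  open Relation.Binary.Reasoning.Setoid setoid

  ∑ℤ-cong : ∀ n {F G} → (∀ j → F j ≈ G j) → ∑ℤ n F ≈ ∑ℤ n G
  ∑ℤ-cong n F≈G = ∑-cong n (λ i → +-cong (F≈G (+ i)) (F≈G -[1+ i ]))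

  ∑ℤ-+ : ∀ n F G → ∑ℤ n (λ j → F j + G j) ≈ ∑ℤ n F + ∑ℤ n G
  ∑ℤ-+ n F G = trans (∑-cong n (λ i → solve 4 (λ a b c d → (a :+ b) :+ (c :+ d) := (a :+ c) :+ (b :+ d)) refl
                       (F (+ i)) (G (+ i)) (F -[1+ i ]) (G -[1+ i ]))) (∑-distrib n _ _)

  ∑ℤ-*ˡ : ∀ n x F → x * ∑ℤ n F ≈ ∑ℤ n (λ j → x * F j)
  ∑ℤ-*ˡ n x F = trans (∑-*ˡ n x _) (∑-cong n (λ i → distribˡ x _ _))

  ∑ℤ-swap : ∀ m n (F : ℤ → ℤ → Carrier) →
            ∑ℤ m (λ i → ∑ℤ n (F i)) ≈ ∑ℤ n (λ j → ∑ℤ m (λ i → F i j))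
  ∑ℤ-swap m n F = begin
    ∑ m (λ i → ∑ℤ n (F (+ i)) + ∑ℤ n (F -[1+ i ]))
      ≈⟨ ∑-cong m (λ i → ∑ℤ-+ n (F (+ i)) (F -[1+ i ])) ⟨
    ∑ m (λ i → ∑ n (λ j → (F (+ i) (+ j) + F -[1+ i ] (+ j)) + (F (+ i) -[1+ j ] + F -[1+ i ] -[1+ j ])))
      ≈⟨ ∑-swap m n _ ⟩
    ∑ n (λ j → ∑ m (λ i → (F (+ i) (+ j) + F -[1+ i ] (+ j)) + (F (+ i) -[1+ j ] + F -[1+ i ] -[1+ j ])))
      ≈⟨ ∑-cong n (λ j → ∑-distrib m _ _) ⟩
    ∑ℤ n (λ j → ∑ℤ m (λ i → F i j)) ∎

  -- The window of `∑ℤ` is -n ≤ j < n; it is preserved by j ↦ -j-1, not by j ↦ -j.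
  ∑ℤ-reflect : ∀ n F → ∑ℤ n F ≈ ∑ℤ n (λ j → F (ℤ.- j ℤ.- ℤ.1ℤ))
  ∑ℤ-reflect n F = ∑-cong n λ i → trans (+-comm _ _) (+-cong (reflexive (≡.cong F (neg i))) refl)
    where
    neg : ∀ i → -[1+ i ] ≡ ℤ.- (+ i) ℤ.- ℤ.1ℤ
    neg zero    = ≡.refl
    neg (suc i) = ≡.cong (λ k → -[1+ suc k ]) (≡.sym (ℕ.+-identityʳ i))

  Supported : ℕ → (ℤ → Carrier) → Set ℓ
  Supported B F = ∀ j → B ≤ ∣ j ∣ → F j ≈ 0#

  ∑ℤ-stable : ∀ {B n} F → Supported B F → B ≤ n → ∑ℤ n F ≈ ∑ℤ B F
  ∑ℤ-stable {B} {n} F supp B≤n = begin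
    ∑ℤ n F                   ≡⟨ ≡.cong (λ n → ∑ℤ n F) (≡.sym (ℕ.m+[n∸m]≡n B≤n)) ⟩
    ∑ℤ (B ℕ.+ (n ℕ.∸ B)) F   ≈⟨ ∑-split B (n ℕ.∸ B) _ ⟩
    ∑ℤ B F + ∑ (n ℕ.∸ B) (λ i → F (+ (B ℕ.+ i)) + F -[1+ B ℕ.+ i ])
      ≈⟨ +-congˡ (∑-zero (n ℕ.∸ B) (λ i → trans
           (+-cong (supp (+ (B ℕ.+ i)) (ℕ.m≤m+n B i)) (supp -[1+ B ℕ.+ i ] (ℕ.m≤n⇒m≤1+n (ℕ.m≤m+n B i)))) (+-identityʳ 0#))) ⟩
    ∑ℤ B F + 0#              ≈⟨ +-identityʳ _ ⟩
    ∑ℤ B F                   ∎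

  ∑ℤ-window : ∀ {m n} F → Supported N F → N ≤ m → N ≤ n → ∑ℤ m F ≈ ∑ℤ n F
  ∑ℤ-window F supp N≤m N≤n = trans (∑ℤ-stable F supp N≤m) (sym (∑ℤ-stable F supp N≤n))

  supported-shift : ∀ {B F} y → Supported B F → Supported (B ℕ.+ ∣ y ∣) (λ j → F (j ℤ.+ y))
  supported-shift {B} y supp j le = supp (j ℤ.+ y) (∣shift∣ B j y le)

  -- Substituting j + 1 moves the window to -n < j ≤ n, so that only the two end terms differ.
  ∑ℤ-suc : ∀ n F → ∑ℤ n (λ j → F (ℤ.suc j)) + F (ℤ.- (+ n)) ≈ ∑ℤ n F + F (+ n)
  ∑ℤ-suc zero    F = refl
  ∑ℤ-suc (suc n) F = begin
    ∑ℤ (suc n) G + F -[1+ n ]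
      ≈⟨ +-congʳ (∑-last n _) ⟩
    (∑ℤ n G + (F (+ suc n) + F (ℤ.suc -[1+ n ]))) + F -[1+ n ]
      ≈⟨ +-congʳ (+-congˡ (+-congˡ (reflexive (≡.cong F (suc-neg n))))) ⟩
    (∑ℤ n G + (F (+ suc n) + F (ℤ.- (+ n)))) + F -[1+ n ]
      ≈⟨ solve 4 (λ a b c d → (a :+ (b :+ c)) :+ d := (a :+ c) :+ (b :+ d)) refl _ _ _ _ ⟩
    (∑ℤ n G + F (ℤ.- (+ n))) + (F (+ suc n) + F -[1+ n ])
      ≈⟨ +-congʳ (∑ℤ-suc n F) ⟩
    (∑ℤ n F + F (+ n)) + (F (+ suc n) + F -[1+ n ])
      ≈⟨ solve 4 (λ a b c d → (a :+ b) :+ (c :+ d) := (a :+ (b :+ d)) :+ c) refl _ _ _ _ ⟩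
    (∑ℤ n F + (F (+ n) + F -[1+ n ])) + F (+ suc n)
      ≈⟨ +-congʳ (∑-last n _) ⟨
    ∑ℤ (suc n) F + F (+ suc n) ∎
    where
    G : ℤ → Carrier
    G j = F (ℤ.suc j)

  ∑ℤ-suc-supported : ∀ {B n} F → Supported B F → B ≤ n → ∑ℤ n (λ j → F (ℤ.suc j)) ≈ ∑ℤ n F
  ∑ℤ-suc-supported {B} {n} F supp B≤n = begin
    ∑ℤ n G                    ≈⟨ +-identityʳ _ ⟨
    ∑ℤ n G + 0#               ≈⟨ +-congˡ (supp (ℤ.- (+ n)) (ℕ.≤-trans B≤n (ℕ.≤-reflexive (≡.sym (ℤ.∣-i∣≡∣i∣ (+ n)))))) ⟨
    ∑ℤ n G + F (ℤ.- (+ n))    ≈⟨ ∑ℤ-suc n F ⟩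
    ∑ℤ n F + F (+ n)          ≈⟨ +-congˡ (supp (+ n) B≤n) ⟩
    ∑ℤ n F + 0#               ≈⟨ +-identityʳ _ ⟩
    ∑ℤ n F                    ∎
    where
    G : ℤ → Carrier
    G j = F (ℤ.suc j)

  ∑ℤ-shift : ∀ {B n} F y → Supported B F → B ℕ.+ ∣ y ∣ ≤ n → ∑ℤ n (λ j → F (j ℤ.+ y)) ≈ ∑ℤ n F
  ∑ℤ-shift {n = n} F (+ zero) supp le = ∑ℤ-cong n (λ j → reflexive (≡.cong F (ℤ.+-identityʳ j)))
  ∑ℤ-shift {B} {n} F (+ suc m) supp le = begin
    ∑ℤ n (λ j → F (j ℤ.+ + suc m))
      ≈⟨ ∑ℤ-cong n (λ j → reflexive (≡.cong F (solveℤ 2 (λ j m → j ⊕ (conℤ ℤ.1ℤ ⊕ m) ⊜ (conℤ ℤ.1ℤ ⊕ j) ⊕ m) ≡.refl j (+ m)))) ⟩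
    ∑ℤ n (λ j → F (ℤ.suc j ℤ.+ + m))
      ≈⟨ ∑ℤ-suc-supported (λ j → F (j ℤ.+ + m)) (supported-shift (+ m) supp) le′ ⟩
    ∑ℤ n (λ j → F (j ℤ.+ + m))
      ≈⟨ ∑ℤ-shift F (+ m) supp le′ ⟩
    ∑ℤ n F ∎
    where
    le′ : B ℕ.+ m ≤ n
    le′ = ℕ.≤-trans (ℕ.+-monoʳ-≤ B (ℕ.n≤1+n m)) le
  ∑ℤ-shift {B} {n} F -[1+ m ] supp le = begin
    ∑ℤ n (λ j → F (j ℤ.+ -[1+ m ]))
      ≈⟨ ∑ℤ-suc-supported (λ j → F (j ℤ.+ -[1+ m ])) (supported-shift -[1+ m ] supp) le ⟨
    ∑ℤ n (λ j → F (ℤ.suc j ℤ.+ -[1+ m ]))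
      ≈⟨ ∑ℤ-cong n (λ j → reflexive (≡.cong F (≡.trans
           (solveℤ 2 (λ j y → (conℤ ℤ.1ℤ ⊕ j) ⊕ y ⊜ j ⊕ (conℤ ℤ.1ℤ ⊕ y)) ≡.refl j -[1+ m ])
           (≡.cong (λ k → j ℤ.+ k) (suc-neg m))))) ⟩
    ∑ℤ n (λ j → F (j ℤ.- + m))
      ≈⟨ shorter m le ⟩
    ∑ℤ n F ∎
    where
    shorter : ∀ m → B ℕ.+ suc m ≤ n → ∑ℤ n (λ j → F (j ℤ.- + m)) ≈ ∑ℤ n F
    shorter zero    le = ∑ℤ-cong n (λ j → reflexive (≡.cong F (ℤ.+-identityʳ j)))
    shorter (suc m) le = ∑ℤ-shift F -[1+ m ] supp (ℕ.≤-trans (ℕ.+-monoʳ-≤ B (ℕ.n≤1+n (suc m))) le)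


  -- On the negative half, -(1 + 3k + r) = 3(-1 - k) + (2 - r): remainder r there joins remainder 2
  -- - r of the non-negative half.
  ∑ℤ-thirds : ∀ n F → ∑ℤ (n ℕ.* 3) F ≈
    ∑ℤ n (λ k → F (3* k + 0)) + (∑ℤ n (λ k → F (3* k + 1)) + ∑ℤ n (λ k → F (3* k + 2)))
  ∑ℤ-thirds n F = begin
    ∑ℤ (n ℕ.* 3) F
      ≈⟨ ∑-blocks n 3 _ ⟩
    ∑ 3 (λ r → ∑ n (λ k → F (+ (k ℕ.* 3 ℕ.+ r)) + F -[1+ k ℕ.* 3 ℕ.+ r ]))
      ≈⟨ +-cong (∑-distrib n _ _) (+-cong (∑-distrib n _ _) (trans (+-identityʳ _) (∑-distrib n _ _))) ⟩
    (up 0 + down 0) + ((up 1 + down 1) + (up 2 + down 2))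
      ≈⟨ solve 6 (λ a b c d e f → (a :+ b) :+ ((c :+ d) :+ (e :+ f)) := (a :+ f) :+ ((c :+ d) :+ (e :+ b))) refl _ _ _ _ _ _ ⟩
    (up 0 + down 2) + ((up 1 + down 1) + (up 2 + down 0))
      ≈⟨ +-cong (both 0 2 (solveℤ 1 (λ K → ⊖ (conℤ (+ 1) ⊕ (K ⊗ conℤ (+ 3) ⊕ conℤ (+ 2))) ⊜ conℤ (+ 3) ⊗ (⊖ (conℤ (+ 1) ⊕ K)) ⊕ conℤ (+ 0)) ≡.refl))
           (+-cong (both 1 1 (solveℤ 1 (λ K → ⊖ (conℤ (+ 1) ⊕ (K ⊗ conℤ (+ 3) ⊕ conℤ (+ 1))) ⊜ conℤ (+ 3) ⊗ (⊖ (conℤ (+ 1) ⊕ K)) ⊕ conℤ (+ 1)) ≡.refl))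
                   (both 2 0 (solveℤ 1 (λ K → ⊖ (conℤ (+ 1) ⊕ (K ⊗ conℤ (+ 3) ⊕ conℤ (+ 0))) ⊜ conℤ (+ 3) ⊗ (⊖ (conℤ (+ 1) ⊕ K)) ⊕ conℤ (+ 2)) ≡.refl))) ⟩
    ∑ℤ n (λ k → F (3* k + 0)) + (∑ℤ n (λ k → F (3* k + 1)) + ∑ℤ n (λ k → F (3* k + 2))) ∎
    where
    up down : ℕ → Carrier
    up   r = ∑ n (λ k → F (+ (k ℕ.* 3 ℕ.+ r)))
    down r = ∑ n (λ k → F -[1+ k ℕ.* 3 ℕ.+ r ])
    pos-index : ∀ r k → + (k ℕ.* 3 ℕ.+ r) ≡ + k ℤ.* + 3 ℤ.+ + r
    pos-index r k = ≡.cong (ℤ._+ + r) (ℤ.pos-* k 3)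
    up-index : ∀ r k → + (k ℕ.* 3 ℕ.+ r) ≡ 3* + k + r
    up-index r k = ≡.trans (pos-index r k) (≡.cong (ℤ._+ + r) (ℤ.*-comm (+ k) (+ 3)))
    DownIndex : ℕ → ℕ → Set
    DownIndex s r = ∀ K → ℤ.- (+ 1 ℤ.+ (K ℤ.* + 3 ℤ.+ + r)) ≡ + 3 ℤ.* (ℤ.- (+ 1 ℤ.+ K)) ℤ.+ + s
    both : ∀ s r → DownIndex s r → up s + down r ≈ ∑ℤ n (λ k → F (3* k + s))
    both s r down-index = trans (sym (∑-distrib n _ _)) (∑-cong n (λ k → +-cong
      (reflexive (≡.cong F (up-index s k)))
      (reflexive (≡.cong F (≡.trans (≡.cong (λ z → ℤ.- (+ 1 ℤ.+ z)) (pos-index r k)) (down-index (+ k)))))))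

-- Sums of squares, the lattice of norm 3, and cube roots of unity

square-abs : ∀ j → + (∣ j ∣ ℕ.* ∣ j ∣) ≡ j ℤ.* j
square-abs (+ n)    = ℤ.pos-* n n
square-abs -[1+ n ] = ≡.refl

m≤m*m : ∀ m → m ≤ m ℕ.* m
m≤m*m zero    = z≤n
m≤m*m (suc m) = ℕ.m≤m*n (suc m) (suc m)

k≤∣3k+r∣ : ∀ k {r} → r ≤ 2 → ∣ k ∣ ≤ ∣ 3* k + r ∣
k≤∣3k+r∣ k {r} r≤2 = bound ∣ k ∣ ≡.refl
  where
  open ℕ.≤-Reasoning
  bound : ∀ m → ∣ k ∣ ≡ m → m ≤ ∣ 3* k + r ∣
  bound zero    eq = z≤n
  bound (suc m) eq = ∣shift∣ (suc m) (+ 3 ℤ.* k) (+ r) (begin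
    suc m ℕ.+ r             ≤⟨ ℕ.+-monoʳ-≤ (suc m) r≤2 ⟩
    suc m ℕ.+ 2             ≤⟨ ℕ.+-monoʳ-≤ (suc m) (ℕ.m≤m+n 2 (m ℕ.+ m)) ⟩
    suc m ℕ.+ (2 ℕ.+ (m ℕ.+ m))   ≡⟨ ℕS.solve 1 (λ m → (ℕS.con 1 ℕS.:+ m) ℕS.:+ (ℕS.con 2 ℕS.:+ (m ℕS.:+ m)) ℕS.:= ℕS.con 3 ℕS.:* (ℕS.con 1 ℕS.:+ m)) ≡.refl m ⟩
    3 ℕ.* suc m             ≡⟨ ≡.cong (3 ℕ.*_) eq ⟨
    3 ℕ.* ∣ k ∣             ≡⟨ ℤ.abs-* (+ 3) k ⟨
    ∣ + 3 ℤ.* k ∣           ∎)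


module SquareSums {c ℓ} (R : CommutativeRing c ℓ) (N : ℕ) where
  open Nilpotent R N
  open BilateralSums R N
  open Relation.Binary.Reasoning.Setoid setoid

  sq : Carrier → ℤ → Carrier
  sq x j = x ^ (∣ j ∣ ℕ.* ∣ j ∣)

  ^^ : ∀ x m n {k} → m ℕ.* n ≡ k → (x ^ m) ^ n ≈ x ^ k
  ^^ x m n eq = trans (^-assocʳ x m n) (^-congʳ x eq)

  sq-supported : ∀ {x} → Nil x → Supported N (sq x)
  sq-supported nil j N≤j = Nil-≥ nil (ℕ.≤-trans N≤j (m≤m*m ∣ j ∣))

  φ : Carrier → Carrier
  φ x = ∑ℤ W (sq x)

  third : ℕ → Carrier → ℤ → Carrier
  third r x k = sq x (3* k + r)

  third-supported : ∀ {r x} → r ≤ 2 → Nil x → Supported N (third r x)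
  third-supported {r} r≤2 nil k N≤k = sq-supported nil (3* k + r) (ℕ.≤-trans N≤k (k≤∣3k+r∣ k r≤2))

  residueSum : ℕ → Carrier → Carrier
  residueSum r x = ∑ℤ W (third r x)

  -- k ↦ -k-1 turns 3k + 2 into -(3k + 1), which has the same square.
  residueSum₂≈₁ : ∀ x → residueSum 2 x ≈ residueSum 1 x
  residueSum₂≈₁ x = trans (∑ℤ-reflect W (third 2 x)) (∑ℤ-cong W λ k → ^-congʳ x (≡.cong (λ n → n ℕ.* n) (index k)))
    where
    index : ∀ k → ∣ 3* (ℤ.- k ℤ.- ℤ.1ℤ) + 2 ∣ ≡ ∣ 3* k + 1 ∣
    index k = ≡.trans (≡.cong ∣_∣ (solveℤ 1 (λ k → conℤ (+ 3) ⊗ ((⊖ k) ⊕ conℤ -[1+ 0 ]) ⊕ conℤ (+ 2) ⊜ ⊖ (conℤ (+ 3) ⊗ k ⊕ conℤ (+ 1))) ≡.refl k))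
                      (ℤ.∣-i∣≡∣i∣ (3* k + 1))

  φ-thirds : ∀ {x} → Nil x → φ x ≈ residueSum 0 x + (residueSum 1 x + residueSum 1 x)
  φ-thirds {x} nil = begin
    φ x                          ≈⟨ ∑ℤ-window (sq x) (sq-supported nil) N≤W (ℕ.≤-trans N≤W (ℕ.m≤m*n W 3)) ⟩
    ∑ℤ (W ℕ.* 3) (sq x)          ≈⟨ ∑ℤ-thirds W (sq x) ⟩
    residueSum 0 x + (residueSum 1 x + residueSum 2 x)      ≈⟨ +-congˡ (+-congˡ (residueSum₂≈₁ x)) ⟩
    residueSum 0 x + (residueSum 1 x + residueSum 1 x)      ∎

  residueSum₀≈φ : ∀ x → residueSum 0 x ≈ φ (x ^ 9)
  residueSum₀≈φ x = ∑ℤ-cong W λ k → sym (^^ x 9 (∣ k ∣ ℕ.* ∣ k ∣) (≡.trans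
    (ℕS.solve 1 (λ m → ℕS.con 9 ℕS.:* (m ℕS.:* m) ℕS.:= (ℕS.con 3 ℕS.:* m) ℕS.:* (ℕS.con 3 ℕS.:* m)) ≡.refl ∣ k ∣)
    (≡.cong (λ n → n ℕ.* n) (≡.sym (≡.trans (≡.cong ∣_∣ (ℤ.+-identityʳ (+ 3 ℤ.* k))) (ℤ.abs-* (+ 3) k))))))

  -- Multiplicativity of the norm of ℤ[√-2] for an element of norm 3: 6y² + 3(Y + y)² = 2Y² + (Y +
  -- 3y)². Using Y and y as coordinates makes the second square run over Y plus multiples of 3, so
  -- the congruence of the lattice is built in.
  lattice-exponent : ∀ x y Y → sq (x ^ 6) y * sq (x ^ 3) (Y ℤ.+ y) ≈ sq (x ^ 2) Y * sq x (Y ℤ.+ + 3 ℤ.* y)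
  lattice-exponent x y Y = begin
    sq (x ^ 6) y * sq (x ^ 3) (Y ℤ.+ y)
      ≈⟨ *-cong (^-assocʳ x 6 (∣ y ∣ ℕ.* ∣ y ∣)) (^-assocʳ x 3 (∣ Y ℤ.+ y ∣ ℕ.* ∣ Y ℤ.+ y ∣)) ⟩
    x ^ (6 ℕ.* n y) * x ^ (3 ℕ.* n (Y ℤ.+ y))
      ≈⟨ ^-homo-* x (6 ℕ.* n y) (3 ℕ.* n (Y ℤ.+ y)) ⟨
    x ^ (6 ℕ.* n y ℕ.+ 3 ℕ.* n (Y ℤ.+ y))
      ≡⟨ ≡.cong (x ^_) (ℤ.+-injective norms) ⟩
    x ^ (2 ℕ.* n Y ℕ.+ n (Y ℤ.+ + 3 ℤ.* y))
      ≈⟨ ^-homo-* x (2 ℕ.* n Y) (n (Y ℤ.+ + 3 ℤ.* y)) ⟩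
    x ^ (2 ℕ.* n Y) * x ^ n (Y ℤ.+ + 3 ℤ.* y)
      ≈⟨ *-congʳ (^-assocʳ x 2 (n Y)) ⟨
    sq (x ^ 2) Y * sq x (Y ℤ.+ + 3 ℤ.* y) ∎
    where
    n : ℤ → ℕ
    n j = ∣ j ∣ ℕ.* ∣ j ∣
    pos : ∀ m j → + (m ℕ.* n j) ≡ + m ℤ.* (j ℤ.* j)
    pos m j = ≡.trans (ℤ.pos-* m (n j)) (≡.cong (+ m ℤ.*_) (square-abs j))
    norms : + (6 ℕ.* n y ℕ.+ 3 ℕ.* n (Y ℤ.+ y)) ≡ + (2 ℕ.* n Y ℕ.+ n (Y ℤ.+ + 3 ℤ.* y))
    norms = ≡.trans (≡.cong₂ ℤ._+_ (pos 6 y) (pos 3 (Y ℤ.+ y))) (≡.trans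
      (solveℤ 2 (λ y Y → conℤ (+ 6) ⊗ (y ⊗ y) ⊕ conℤ (+ 3) ⊗ ((Y ⊕ y) ⊗ (Y ⊕ y))
        ⊜ conℤ (+ 2) ⊗ (Y ⊗ Y) ⊕ (Y ⊕ conℤ (+ 3) ⊗ y) ⊗ (Y ⊕ conℤ (+ 3) ⊗ y)) ≡.refl y Y)
      (≡.sym (≡.cong₂ ℤ._+_ (pos 2 Y) (square-abs (Y ℤ.+ + 3 ℤ.* y)))))

  -- If |y| ≥ N the weight `G y` is 0; otherwise the shift by y fits into a window of size 2N.
  shift-weighted : ∀ F G {n} → Supported N F → Supported N G → N ℕ.+ N ≤ n →
                   ∀ y → G y * ∑ℤ n F ≈ G y * ∑ℤ n (λ j → F (j ℤ.+ y))
  shift-weighted F G {n} F-supp G-supp 2N≤n y with N ℕ.≤? ∣ y ∣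
  ... | yes N≤y = trans (trans (*-congʳ (G-supp y N≤y)) (zeroˡ _)) (sym (trans (*-congʳ (G-supp y N≤y)) (zeroˡ _)))
  ... | no  N≰y = *-congˡ (sym (∑ℤ-shift F y F-supp (ℕ.≤-trans (ℕ.+-monoʳ-≤ N (ℕ.<⇒≤ (ℕ.≰⇒> N≰y))) 2N≤n)))

  -- 3x² + 6y² = X² + 2Y² for X = x + 2y and Y = x - y, and these pairs (X , Y) form
  -- the lattice X ≡ Y mod 3.
  φ-lattice : ∀ {x} → Nil x → φ (x ^ 3) * φ (x ^ 6) ≈ residueSum 0 (x ^ 2) * residueSum 0 x + (residueSum 1 (x ^ 2) * residueSum 1 x + residueSum 1 (x ^ 2) * residueSum 1 x)
  φ-lattice {x} nil = begin
    φ (x ^ 3) * φ (x ^ 6)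
      ≈⟨ *-cong (window (sq (x ^ 3)) (sq-supported x³) N≤n) (window (sq (x ^ 6)) (sq-supported x⁶) N≤n) ⟩
    ∑ℤ n (sq (x ^ 3)) * ∑ℤ n (sq (x ^ 6))
      ≈⟨ ∑ℤ-*ˡ n (∑ℤ n (sq (x ^ 3))) (sq (x ^ 6)) ⟩
    ∑ℤ n (λ y → ∑ℤ n (sq (x ^ 3)) * sq (x ^ 6) y)
      ≈⟨ ∑ℤ-cong n (λ y → trans (*-comm (∑ℤ n (sq (x ^ 3))) (sq (x ^ 6) y)) (shift-weighted (sq (x ^ 3)) (sq (x ^ 6)) (sq-supported x³) (sq-supported x⁶) 2N≤n y)) ⟩
    ∑ℤ n (λ y → sq (x ^ 6) y * ∑ℤ n (λ Y → sq (x ^ 3) (Y ℤ.+ y)))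
      ≈⟨ ∑ℤ-cong n (λ y → trans (∑ℤ-*ˡ n (sq (x ^ 6) y) (λ Y → sq (x ^ 3) (Y ℤ.+ y)))
                        (∑ℤ-cong n {λ Y → sq (x ^ 6) y * sq (x ^ 3) (Y ℤ.+ y)} {λ Y → weight Y y} (λ Y → lattice-exponent x y Y))) ⟩
    ∑ℤ n (λ y → ∑ℤ n (λ Y → weight Y y))
      ≈⟨ ∑ℤ-swap n n (λ y Y → weight Y y) ⟩
    ∑ℤ n (λ Y → ∑ℤ n (weight Y))
      ≈⟨ ∑ℤ-cong n (λ Y → sym (∑ℤ-*ˡ n (sq (x ^ 2) Y) (λ y → sq x (Y ℤ.+ + 3 ℤ.* y)))) ⟩
    ∑ℤ n (λ Y → sq (x ^ 2) Y * ∑ℤ n (λ y → sq x (Y ℤ.+ + 3 ℤ.* y)))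
      ≈⟨ ∑ℤ-thirds (N ℕ.+ N) (λ Y → sq (x ^ 2) Y * ∑ℤ n (λ y → sq x (Y ℤ.+ + 3 ℤ.* y))) ⟩
    residue 0 + (residue 1 + residue 2)
      ≈⟨ +-cong (residue≈ 0 z≤n) (+-cong (residue≈ 1 (s≤s z≤n)) (trans (residue≈ 2 (s≤s (s≤s z≤n))) (*-cong (residueSum₂≈₁ (x ^ 2)) (residueSum₂≈₁ x)))) ⟩
    residueSum 0 (x ^ 2) * residueSum 0 x + (residueSum 1 (x ^ 2) * residueSum 1 x + residueSum 1 (x ^ 2) * residueSum 1 x) ∎
    where
    -- A multiple of 3 for the split into residue classes, and at least 2N to leave room for shifts
    -- by less than N.
    n : ℕ
    n = (N ℕ.+ N) ℕ.* 3
    2N≤n : N ℕ.+ N ≤ n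
    2N≤n = ℕ.m≤m*n (N ℕ.+ N) 3
    N≤2N : N ≤ N ℕ.+ N
    N≤2N = ℕ.m≤m+n N N
    N≤n : N ≤ n
    N≤n = ℕ.≤-trans N≤2N 2N≤n
    x² : Nil (x ^ 2)
    x² = Nil-*ʳ _ nil
    x³ : Nil (x ^ 3)
    x³ = Nil-*ʳ _ nil
    x⁶ : Nil (x ^ 6)
    x⁶ = Nil-*ʳ _ nil
    window : ∀ {m} F → Supported N F → N ≤ m → ∑ℤ W F ≈ ∑ℤ m F
    window F supp N≤m = ∑ℤ-window F supp N≤W N≤m
    weight : ℤ → ℤ → Carrier
    weight Y y = sq (x ^ 2) Y * sq x (Y ℤ.+ + 3 ℤ.* y)
    residue : ℕ → Carrier
    residue r = ∑ℤ (N ℕ.+ N) (λ k → third r (x ^ 2) k * ∑ℤ n (λ y → sq x ((3* k + r) ℤ.+ + 3 ℤ.* y)))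
    index : ∀ k r y → (3* k + r) ℤ.+ + 3 ℤ.* y ≡ 3* (y ℤ.+ k) + r
    index k r y = solveℤ 3 (λ k r y → (conℤ (+ 3) ⊗ k ⊕ r) ⊕ conℤ (+ 3) ⊗ y ⊜ conℤ (+ 3) ⊗ (y ⊕ k) ⊕ r) ≡.refl k (+ r) y
    -- For Y = 3k + r the inner index Y + 3y equals 3(y + k) + r, the same class shifted by k;
    -- undoing the shift decouples the two sums.
    residue≈ : ∀ r → r ≤ 2 → residue r ≈ residueSum r (x ^ 2) * residueSum r x
    residue≈ r r≤2 = begin
      residue r
        ≈⟨ ∑ℤ-cong (N ℕ.+ N) (λ k → *-congˡ {third r (x ^ 2) k} (∑ℤ-cong n {λ y → sq x ((3* k + r) ℤ.+ + 3 ℤ.* y)} {λ y → third r x (y ℤ.+ k)}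
             (λ y → reflexive (≡.cong (sq x) (index k r y))))) ⟩
      ∑ℤ (N ℕ.+ N) (λ k → third r (x ^ 2) k * ∑ℤ n (λ y → third r x (y ℤ.+ k)))
        ≈⟨ ∑ℤ-cong (N ℕ.+ N) (λ k → trans (sym (shift-weighted (third r x) (third r (x ^ 2)) (third-supported r≤2 nil) (third-supported r≤2 x²) 2N≤n k))
                                            (*-comm (third r (x ^ 2) k) (∑ℤ n (third r x)))) ⟩
      ∑ℤ (N ℕ.+ N) (λ k → ∑ℤ n (third r x) * third r (x ^ 2) k)
        ≈⟨ ∑ℤ-*ˡ (N ℕ.+ N) (∑ℤ n (third r x)) (third r (x ^ 2)) ⟨
      ∑ℤ n (third r x) * ∑ℤ (N ℕ.+ N) (third r (x ^ 2))
        ≈⟨ *-cong (window (third r x) (third-supported r≤2 nil) N≤n) (window (third r (x ^ 2)) (third-supported r≤2 x²) N≤2N) ⟨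
      residueSum r x * residueSum r (x ^ 2)
        ≈⟨ *-comm _ _ ⟩
      residueSum r (x ^ 2) * residueSum r x ∎

  triangle-square : ∀ i → i ℕ.+ (triangle i ℕ.+ triangle i) ≡ i ℕ.* i
  triangle-square zero    = ≡.refl
  triangle-square (suc i) = ≡.trans
    (ℕS.solve 2 (λ i t → (ℕS.con 1 ℕS.:+ i) ℕS.:+ ((t ℕS.:+ i) ℕS.:+ (t ℕS.:+ i)) ℕS.:= ℕS.con 1 ℕS.:+ i ℕS.:+ i ℕS.:+ (i ℕS.:+ (t ℕS.:+ t))) ≡.refl i (triangle i))
    (≡.trans (≡.cong (1 ℕ.+ i ℕ.+ i ℕ.+_) (triangle-square i))
      (ℕS.solve 1 (λ i → ℕS.con 1 ℕS.:+ i ℕS.:+ i ℕS.:+ i ℕS.:* i ℕS.:= (ℕS.con 1 ℕS.:+ i) ℕS.:* (ℕS.con 1 ℕS.:+ i)) ≡.refl i))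

  u-square : ∀ z x i → u (x * x) (z * x) i ≈ z ^ i * x ^ (i ℕ.* i)
  u-square z x i = begin
    (z * x) ^ i * (x * x) ^ triangle i
      ≈⟨ *-cong (^-distrib-* z x i) (^-distrib-* x x (triangle i)) ⟩
    (z ^ i * x ^ i) * (x ^ triangle i * x ^ triangle i)
      ≈⟨ *-assoc _ _ _ ⟩
    z ^ i * (x ^ i * (x ^ triangle i * x ^ triangle i))
      ≈⟨ *-congˡ (*-congˡ (^-homo-* x (triangle i) (triangle i))) ⟨
    z ^ i * (x ^ i * x ^ (triangle i ℕ.+ triangle i))
      ≈⟨ *-congˡ (^-homo-* x i (triangle i ℕ.+ triangle i)) ⟨
    z ^ i * x ^ (i ℕ.+ (triangle i ℕ.+ triangle i))
      ≡⟨ ≡.cong (λ n → z ^ i * x ^ n) (triangle-square i) ⟩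
    z ^ i * x ^ (i ℕ.* i) ∎

  φ-theta : ∀ x → Θ x x ≈ φ x
  φ-theta x = ∑ℤ-cong W {term x x} {sq x} term≈
    where
    one^ : ∀ i → 1# ^ i ≈ 1#
    one^ zero    = refl
    one^ (suc i) = trans (*-identityˡ _) (one^ i)
    square : ∀ i → u (x * x) x i ≈ x ^ (i ℕ.* i)
    square i = trans (u-cong refl (sym (*-identityˡ x)) i) (trans (u-square 1# x i) (trans (*-congʳ (one^ i)) (*-identityˡ _)))
    term≈ : ∀ j → term x x j ≈ sq x j
    term≈ (+ i)    = square i
    term≈ -[1+ i ] = square (suc i)

  module CubeRoot (ω : Carrier) (1+ω+ω² : 1# + (ω + ω * ω) ≈ 0#) where

    ω³ : ω * (ω * ω) ≈ 1#
    ω³ = begin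
      ω * (ω * ω)      ≈⟨ solve 1 (λ w → w :* (w :* w) := (w :- :1) :* (:1 :+ (w :+ w :* w)) :+ :1) refl ω ⟩
      (ω - 1#) * (1# + (ω + ω * ω)) + 1#   ≈⟨ +-congʳ (*-congˡ 1+ω+ω²) ⟩
      (ω - 1#) * 0# + 1#                   ≈⟨ solve 1 (λ w → (w :- :1) :* :0 :+ :1 := :1) refl ω ⟩
      1# ∎

    ω^_ : ℤ → Carrier
    ω^ (+ i)    = ω ^ i
    ω^ -[1+ i ] = (ω * ω) ^ suc i

    ω^suc : ∀ j → ω^ (ℤ.suc j) ≈ ω * ω^ j
    ω^suc (+ i)        = refl
    ω^suc -[1+ 0 ]     = sym (trans (*-congˡ (*-identityʳ _)) ω³)
    ω^suc -[1+ suc i ] = sym (begin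
      ω * ((ω * ω) * (ω * ω) ^ suc i)   ≈⟨ *-assoc _ _ _ ⟨
      (ω * (ω * ω)) * (ω * ω) ^ suc i   ≈⟨ *-congʳ ω³ ⟩
      1# * (ω * ω) ^ suc i              ≈⟨ *-identityˡ _ ⟩
      (ω * ω) ^ suc i                   ∎)

    constant : (f : ℤ → Carrier) → (∀ k → f (ℤ.suc k) ≈ f k) → ∀ k → f k ≈ f (+ 0)
    constant f step (+ zero)     = refl
    constant f step (+ suc i)    = trans (step (+ i)) (constant f step (+ i))
    constant f step -[1+ zero ]  = sym (step -[1+ 0 ])
    constant f step -[1+ suc i ] = trans (sym (step -[1+ suc i ])) (constant f step -[1+ i ])

    ω^-periodic : ∀ r k → ω^ (3* k + r) ≈ ω ^ r
    ω^-periodic r = constant (λ k → ω^ (3* k + r)) λ k → step k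
      where
      step : ∀ k → ω^ (3* ℤ.suc k + r) ≈ ω^ (3* k + r)
      step k = begin
        ω^ (3* ℤ.suc k + r)
          ≡⟨ ≡.cong ω^_ (solveℤ 2 (λ k r → conℤ (+ 3) ⊗ (conℤ (+ 1) ⊕ k) ⊕ r ⊜ conℤ (+ 1) ⊕ (conℤ (+ 1) ⊕ (conℤ (+ 1) ⊕ (conℤ (+ 3) ⊗ k ⊕ r)))) ≡.refl k (+ r)) ⟩
        ω^ (ℤ.suc (ℤ.suc (ℤ.suc (3* k + r))))
          ≈⟨ trans (ω^suc (ℤ.suc (ℤ.suc j))) (*-congˡ (trans (ω^suc (ℤ.suc j)) (*-congˡ (ω^suc j)))) ⟩
        ω * (ω * (ω * ω^ (3* k + r)))
          ≈⟨ solve 2 (λ w z → w :* (w :* (w :* z)) := (w :* (w :* w)) :* z) refl ω (ω^ j) ⟩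
        (ω * (ω * ω)) * ω^ (3* k + r)
          ≈⟨ trans (*-congʳ ω³) (*-identityˡ _) ⟩
        ω^ j ∎
          where j = 3* k + r

    -- ω^j depends only on j modulo 3, the classes 1 and 2 have equal sums, and ω + ω² = -1.
    θ-ω : ∀ {x} → Nil x → Θ (ω * x) ((ω * ω) * x) ≈ residueSum 0 x - residueSum 1 x
    θ-ω {x} nil = begin
      Θ (ω * x) ((ω * ω) * x)
        ≈⟨ ∑ℤ-cong W {term (ω * x) ((ω * ω) * x)} {F} term≈ ⟩
      ∑ℤ W F
        ≈⟨ ∑ℤ-window F (λ j N≤j → trans (*-congˡ {ω^ j} (sq-supported nil j N≤j)) (zeroʳ (ω^ j))) N≤W (ℕ.≤-trans N≤W (ℕ.m≤m*n W 3)) ⟩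
      ∑ℤ (W ℕ.* 3) F
        ≈⟨ ∑ℤ-thirds W F ⟩
      ∑ℤ W (λ k → F (3* k + 0)) + (∑ℤ W (λ k → F (3* k + 1)) + ∑ℤ W (λ k → F (3* k + 2)))
        ≈⟨ +-cong (part 0) (+-cong (part 1) (part 2)) ⟩
      ω ^ 0 * residueSum 0 x + (ω ^ 1 * residueSum 1 x + ω ^ 2 * residueSum 2 x)
        ≈⟨ +-congˡ (+-congˡ (*-congˡ (residueSum₂≈₁ x))) ⟩
      ω ^ 0 * residueSum 0 x + (ω ^ 1 * residueSum 1 x + ω ^ 2 * residueSum 1 x)
        ≈⟨ solve 3 (λ w a b → :1 :* a :+ ((w :* :1) :* b :+ (w :* (w :* :1)) :* b) := (a :- b) :+ (:1 :+ (w :+ w :* w)) :* b) refl ω (residueSum 0 x) (residueSum 1 x) ⟩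
      (residueSum 0 x - residueSum 1 x) + (1# + (ω + ω * ω)) * residueSum 1 x
        ≈⟨ +-congˡ (trans (*-congʳ 1+ω+ω²) (zeroˡ _)) ⟩
      (residueSum 0 x - residueSum 1 x) + 0#
        ≈⟨ +-identityʳ _ ⟩
      residueSum 0 x - residueSum 1 x ∎
      where
      F : ℤ → Carrier
      F j = ω^ j * sq x j
      p≈ : (ω * x) * ((ω * ω) * x) ≈ x * x
      p≈ = trans (solve 2 (λ w x → (w :* x) :* ((w :* w) :* x) := (w :* (w :* w)) :* (x :* x)) refl ω x)
                 (trans (*-congʳ ω³) (*-identityˡ _))
      term≈ : ∀ j → term (ω * x) ((ω * ω) * x) j ≈ F j
      term≈ (+ i)    = trans (u-cong p≈ refl i) (u-square ω x i)
      term≈ -[1+ i ] = trans (u-cong p≈ refl (suc i)) (u-square (ω * ω) x (suc i))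
      part : ∀ r → ∑ℤ W (λ k → F (3* k + r)) ≈ ω ^ r * residueSum r x
      part r = trans (∑ℤ-cong W {λ k → F (3* k + r)} {λ k → ω ^ r * third r x k} (λ k → *-congʳ (ω^-periodic r k)))
                     (sym (∑ℤ-*ˡ W (ω ^ r) (third r x)))

    -- Factor by factor: the product of 1 + ζz over the three cube roots of unity ζ is 1 + z³.
    Q-cube : ∀ x p → Q (- (ω * x)) p * Q (- ((ω * ω) * x)) p * Q (- x) p ≈ Q (- (x * (x * x))) (p * (p * p))
    Q-cube x p = trans (*-congʳ (sym (∏-distrib N _ _))) (trans (sym (∏-distrib N _ _)) (∏-cong N λ i → begin
      (1# - (- (ω * x)) * p ^ i) * (1# - (- ((ω * ω) * x)) * p ^ i) * (1# - (- x) * p ^ i)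
        -- To the solver ω is a free variable, so the deviation from 1 + z³ is spelled out as
        -- multiples of 1 + ω + ω² and of ω³ - 1.
        ≈⟨ solve 3 (λ w x y → (:1 :- (:- (w :* x)) :* y) :* (:1 :- (:- ((w :* w) :* x)) :* y) :* (:1 :- (:- x) :* y)
             := :1 :- (:- (x :* (x :* x))) :* (y :* (y :* y))
                :+ (:1 :+ (w :+ w :* w)) :* (x :* y :+ w :* (x :* y) :* (x :* y))
                :+ (w :* (w :* w) :- :1) :* (x :* y) :* (x :* y) :* (x :* y)) refl ω x (p ^ i) ⟩
      (1# - (- (x * (x * x))) * (p ^ i * (p ^ i * p ^ i)))
        + (1# + (ω + ω * ω)) * (x * p ^ i + ω * (x * p ^ i) * (x * p ^ i))
        + (ω * (ω * ω) - 1#) * (x * p ^ i) * (x * p ^ i) * (x * p ^ i)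
        ≈⟨ +-cong (+-congˡ (*-congʳ 1+ω+ω²)) (*-congʳ (*-congʳ (*-congʳ (trans (+-congʳ ω³) (-‿inverseʳ 1#))))) ⟩
      (1# - (- (x * (x * x))) * (p ^ i * (p ^ i * p ^ i)))
        + 0# * (x * p ^ i + ω * (x * p ^ i) * (x * p ^ i)) + 0# * (x * p ^ i) * (x * p ^ i) * (x * p ^ i)
        ≈⟨ solve 3 (λ a b c → (a :+ :0 :* b) :+ :0 :* c :* c :* c := a) refl _ _ _ ⟩
      1# - (- (x * (x * x))) * (p ^ i * (p ^ i * p ^ i))
        ≈⟨ 1-cong (*-congˡ (trans (^-distrib-* p (p * p) i) (*-congˡ (^-distrib-* p p i)))) ⟨
      1# - (- (x * (x * x))) * (p * (p * p)) ^ i ∎))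

-- Dissection of theta functions by the parity of the index

module EvenOdd {c ℓ} (R : CommutativeRing c ℓ) (N : ℕ) where
  open Nilpotent R N
  open BilateralSums R N
  open Relation.Binary.Reasoning.Setoid setoid

  triangle-even : ∀ k → triangle (k ℕ.* 2) ≡ k ℕ.+ 4 ℕ.* triangle k
  triangle-even zero    = ≡.refl
  triangle-even (suc k) = ≡.trans
    (≡.cong (λ t → (t ℕ.+ k ℕ.* 2) ℕ.+ suc (k ℕ.* 2)) (triangle-even k))
    (ℕS.solve 2 (λ k t → ((k ℕS.:+ ℕS.con 4 ℕS.:* t) ℕS.:+ k ℕS.:* ℕS.con 2) ℕS.:+ (ℕS.con 1 ℕS.:+ k ℕS.:* ℕS.con 2)
      ℕS.:= (ℕS.con 1 ℕS.:+ k) ℕS.:+ ℕS.con 4 ℕS.:* (t ℕS.:+ k)) ≡.refl k (triangle k))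

  u-even : ∀ p x k → u p x (k ℕ.* 2) ≈ u (p ^ 4) (x * x * p) k
  u-even p x k = begin
    x ^ (k ℕ.* 2) * p ^ triangle (k ℕ.* 2)
      ≡⟨ ≡.cong₂ (λ m n → x ^ m * p ^ n) (ℕ.*-comm k 2) (triangle-even k) ⟩
    x ^ (2 ℕ.* k) * p ^ (k ℕ.+ 4 ℕ.* triangle k)
      ≈⟨ *-cong (sym (^-assocʳ x 2 k)) (trans (^-homo-* p k (4 ℕ.* triangle k)) (*-congˡ (sym (^-assocʳ p 4 (triangle k))))) ⟩
    (x ^ 2) ^ k * (p ^ k * (p ^ 4) ^ triangle k)
      ≈⟨ *-assoc _ _ _ ⟨
    ((x ^ 2) ^ k * p ^ k) * (p ^ 4) ^ triangle k
      ≈⟨ *-congʳ (^-distrib-* (x ^ 2) p k) ⟨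
    (x ^ 2 * p) ^ k * (p ^ 4) ^ triangle k
      ≈⟨ *-congʳ (^-congˡ k (*-congʳ (*-congˡ (*-identityʳ x)))) ⟩
    u (p ^ 4) (x * x * p) k ∎

  u-odd : ∀ p x k → u p x (suc (k ℕ.* 2)) ≈ x * u (p ^ 4) (x * x * (p * p * p)) k
  u-odd p x k = begin
    u p x (suc (k ℕ.* 2))
      ≈⟨ u-suc p x (k ℕ.* 2) ⟩
    x * p ^ (k ℕ.* 2) * u p x (k ℕ.* 2)
      ≈⟨ *-cong (*-congˡ (trans (^-congʳ p (ℕ.*-comm k 2)) (trans (sym (^-assocʳ p 2 k)) (^-congˡ k (*-congˡ (*-identityʳ p))))))
                (u-even p x k) ⟩
    x * (p * p) ^ k * ((x * x * p) ^ k * (p ^ 4) ^ triangle k)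
      ≈⟨ solve 4 (λ x a b c → x :* a :* (b :* c) := x :* ((b :* a) :* c)) refl x ((p * p) ^ k) ((x * x * p) ^ k) ((p ^ 4) ^ triangle k) ⟩
    x * (((x * x * p) ^ k * (p * p) ^ k) * (p ^ 4) ^ triangle k)
      ≈⟨ *-congˡ (*-congʳ (^-distrib-* (x * x * p) (p * p) k)) ⟨
    x * u (p ^ 4) (x * x * p * (p * p)) k
      ≈⟨ *-congˡ (u-cong refl (solve 2 (λ x p → x :* x :* p :* (p :* p) := x :* x :* (p :* p :* p)) refl x p) k) ⟩
    x * u (p ^ 4) (x * x * (p * p * p)) k ∎

  -- Serves the odd negative indices. `u-odd` extracts y = xb, whereas the dissection has to extract
  -- x from both halves; the leftover b is absorbed by advancing the index from k to k + 1.
  u-odd-divided : ∀ p x y b k → x * b ≈ y → b * p ≈ y * y → u p y (suc (k ℕ.* 2)) ≈ x * u (p ^ 4) b (suc k)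
  u-odd-divided p x y b k xb≈y bp≈y² = begin
    u p y (suc (k ℕ.* 2))
      ≈⟨ u-odd p y k ⟩
    y * u (p ^ 4) (y * y * (p * p * p)) k
      ≈⟨ *-congˡ (u-cong refl (trans (*-congʳ (sym bp≈y²)) (solve 2 (λ b p → (b :* p) :* (p :* p :* p) := b :* p :^ 4) refl b p)) k) ⟩
    y * u (p ^ 4) (b * p ^ 4) k
      ≈⟨ *-cong (sym xb≈y) (u-scale (p ^ 4) b k) ⟩
    (x * b) * ((p ^ 4) ^ k * u (p ^ 4) b k)
      ≈⟨ solve 4 (λ x b q v → (x :* b) :* (q :* v) := x :* (b :* q :* v)) refl x b ((p ^ 4) ^ k) (u (p ^ 4) b k) ⟩
    x * (b * (p ^ 4) ^ k * u (p ^ 4) b k)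
      ≈⟨ *-congˡ (u-suc (p ^ 4) b k) ⟨
    x * u (p ^ 4) b (suc k) ∎

  term-supported : ∀ {a b} → Nil a → Nil b → Supported N (term a b)
  term-supported a-nil b-nil (+ i)    N≤i = u-nil _ a-nil N≤i
  term-supported a-nil b-nil -[1+ i ] N≤i = u-nil _ b-nil N≤i

  Θ-cong : ∀ {a b a′ b′} → a ≈ a′ → b ≈ b′ → Θ a b ≈ Θ a′ b′
  Θ-cong a≈ b≈ = ∑-cong W λ i → +-cong (u-cong (*-cong a≈ b≈) a≈ i) (u-cong (*-cong a≈ b≈) b≈ (suc i))

  -- Ramanujan's f(a,b) = f(a³b, ab³) + a f(a⁵b³, b/a), by parity of the index. The quotient is an
  -- argument constrained by `a * b/a ≈ b`, since there is no division.
  Θ-even-odd : ∀ a b b/a → Nil a → Nil b → a * b/a ≈ b →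
               Θ a b ≈ Θ (a * a * (a * b)) (b * b * (a * b)) + a * Θ (a * a * (a * b * (a * b) * (a * b))) b/a
  Θ-even-odd a b b/a a-nil b-nil a*b/a≈b = begin
    Θ a b
      ≈⟨ ∑ℤ-window (term a b) (term-supported a-nil b-nil) N≤W (ℕ.≤-trans N≤W (ℕ.m≤m*n W 2)) ⟩
    ∑ℤ (W ℕ.* 2) (term a b)
      ≈⟨ ∑-blocks W 2 (λ i → term a b (+ i) + term a b -[1+ i ]) ⟩
    ∑ 2 (λ r → ∑ W (λ k → u p a (k ℕ.* 2 ℕ.+ r) + u p b (suc (k ℕ.* 2 ℕ.+ r))))
      ≈⟨ +-cong (∑-distrib W _ _) (trans (+-identityʳ _) (∑-distrib W _ _)) ⟩
    (up 0 + down 0) + (up 1 + down 1)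
      ≈⟨ solve 4 (λ a b c d → (a :+ b) :+ (c :+ d) := (a :+ d) :+ (c :+ b)) refl (up 0) (down 0) (up 1) (down 1) ⟩
    (up 0 + down 1) + (up 1 + down 0)
      ≈⟨ +-cong (∑-distrib W _ _) (∑-distrib W _ _) ⟨
    ∑ W (λ k → u p a (k ℕ.* 2 ℕ.+ 0) + u p b (suc (k ℕ.* 2 ℕ.+ 1))) + ∑ W (λ k → u p a (k ℕ.* 2 ℕ.+ 1) + u p b (suc (k ℕ.* 2 ℕ.+ 0)))
      ≈⟨ +-cong (∑-cong W {g = λ k → term (a * a * p) (b * b * p) (+ k) + term (a * a * p) (b * b * p) -[1+ k ]} even)
                (∑-cong W {g = λ k → a * (term (a * a * (p * p * p)) b/a (+ k) + term (a * a * (p * p * p)) b/a -[1+ k ])} odd) ⟩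
    Θ (a * a * p) (b * b * p) + ∑ W (λ k → a * (term (a * a * (p * p * p)) b/a (+ k) + term (a * a * (p * p * p)) b/a -[1+ k ]))
      ≈⟨ +-congˡ (∑-*ˡ W a _) ⟨
    Θ (a * a * p) (b * b * p) + a * Θ (a * a * (p * p * p)) b/a ∎
    where
    p : Carrier
    p = a * b
    up down : ℕ → Carrier
    up   r = ∑ W (λ k → u p a (k ℕ.* 2 ℕ.+ r))
    down r = ∑ W (λ k → u p b (suc (k ℕ.* 2 ℕ.+ r)))
    at : ∀ {m n} x → m ≡ n → u p x m ≈ u p x n
    at x eq = reflexive (≡.cong (u p x) eq)
    p⁴-even : p ^ 4 ≈ (a * a * p) * (b * b * p)
    p⁴-even = solve 2 (λ a b → (a :* b) :^ 4 := (a :* a :* (a :* b)) :* (b :* b :* (a :* b))) refl a b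
    p⁴-odd : p ^ 4 ≈ (a * a * (p * p * p)) * b/a
    p⁴-odd = begin
      p * (p * (p * (p * 1#)))
        ≈⟨ solve 2 (λ p a → p :^ 4 := p :* (p :* p :* p)) refl p a ⟩
      a * b * (p * p * p)
        ≈⟨ *-congʳ (*-congˡ a*b/a≈b) ⟨
      a * (a * b/a) * (p * p * p)
        ≈⟨ solve 3 (λ a r p → a :* (a :* r) :* p := (a :* a :* p) :* r) refl a b/a (p * p * p) ⟩
      (a * a * (p * p * p)) * b/a ∎
    b/a-p : b/a * p ≈ b * b
    b/a-p = trans (solve 3 (λ r a b → r :* (a :* b) := (a :* r) :* b) refl b/a a b) (*-congʳ a*b/a≈b)
    even : ∀ k → u p a (k ℕ.* 2 ℕ.+ 0) + u p b (suc (k ℕ.* 2 ℕ.+ 1))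
                 ≈ term (a * a * p) (b * b * p) (+ k) + term (a * a * p) (b * b * p) -[1+ k ]
    even k = +-cong
      (trans (at a (ℕ.+-identityʳ (k ℕ.* 2))) (trans (u-even p a k) (u-cong p⁴-even refl k)))
      (trans (at b (≡.cong suc (ℕ.+-comm (k ℕ.* 2) 1))) (trans (u-even p b (suc k)) (u-cong p⁴-even refl (suc k))))
    odd : ∀ k → u p a (k ℕ.* 2 ℕ.+ 1) + u p b (suc (k ℕ.* 2 ℕ.+ 0))
                ≈ a * (term (a * a * (p * p * p)) b/a (+ k) + term (a * a * (p * p * p)) b/a -[1+ k ])
    odd k = trans (+-cong
      (trans (at a (ℕ.+-comm (k ℕ.* 2) 1)) (trans (u-odd p a k) (*-congˡ (u-cong p⁴-odd refl k))))
      (trans (at b (≡.cong suc (ℕ.+-identityʳ (k ℕ.* 2))))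
        (trans (u-odd-divided p a b b/a k a*b/a≈b b/a-p) (*-congˡ (u-cong p⁴-odd refl (suc k))))))
      (sym (distribˡ a _ _))

-- Product formulas for the theta functions involved

module ThetaProducts {c ℓ} (R : CommutativeRing c ℓ) (N : ℕ) where
  open Nilpotent R N
  open BilateralSums R N
  open SquareSums R N
  open EvenOdd R N
  open Relation.Binary.Reasoning.Setoid setoid

  Q-halves : ∀ x {p} → Nil p → Q x p ≈ Q x (p * p) * Q (x * p) (p * p)
  Q-halves x {p} nil = trans (Q-blocks 1 x nil) (*-cong
    (Q-cong (*-identityʳ x) pp)
    (trans (*-identityʳ _) (Q-cong (*-congˡ (*-identityʳ p)) pp)))
    where
    pp : p ^ 2 ≈ p * p
    pp = *-congˡ (*-identityʳ p)

  Q-thirds : ∀ x {p} → Nil p → Q x p ≈ Q x (p ^ 3) * Q (x * p) (p ^ 3) * Q (x * (p * p)) (p ^ 3)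
  Q-thirds x {p} nil = trans (Q-blocks 2 x nil) (trans
    (*-cong (Q-cong (*-identityʳ x) refl) (*-cong (Q-cong (*-congˡ (*-identityʳ p)) refl)
      (trans (*-identityʳ _) (Q-cong (*-congˡ (*-congˡ (*-identityʳ p))) refl))))
    (sym (*-assoc _ _ _)))

  G H A B : Carrier → Carrier
  G x = Θ (- (x ^ 11)) (- x)
  H x = Θ (- (x ^ 5)) (- (x ^ 7))
  A x = Θ x (- (x * x))
  B x = Θ (- x) (x * x)

  -- With a = x and b = -x² the dissection has a³b = -x⁵, ab³ = -x⁷, a⁵b³ = -x¹¹ and b/a = -x, the
  -- parameters of `H` and `G`. For `B`, a = -x and b = x² give the same four and flip the sign of
  -- the odd part.
  A≈H+xG : ∀ {x} → Nil x → A x ≈ H x + x * G x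
  A≈H+xG {x} nil = trans
    (Θ-even-odd x (- (x * x)) (- x) nil (Nil-neg (Nil-*ʳ x nil)) (solve 1 (λ x → x :* (:- x) := :- (x :* x)) refl x))
    (+-cong (Θ-cong (solve 1 (λ x → x :* x :* (x :* (:- (x :* x))) := :- (x :^ 5)) refl x)
                    (solve 1 (λ x → (:- (x :* x)) :* (:- (x :* x)) :* (x :* (:- (x :* x))) := :- (x :^ 7)) refl x))
            (*-congˡ (Θ-cong (solve 1 (λ x → let p = x :* (:- (x :* x)) in x :* x :* (p :* p :* p) := :- (x :^ 11)) refl x) refl)))

  B≈H-xG : ∀ {x} → Nil x → B x ≈ H x - x * G x
  B≈H-xG {x} nil = trans
    (Θ-even-odd (- x) (x * x) (- x) (Nil-neg nil) (Nil-*ʳ x nil) (solve 1 (λ x → (:- x) :* (:- x) := x :* x) refl x))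
    (+-cong (Θ-cong (solve 1 (λ x → (:- x) :* (:- x) :* ((:- x) :* (x :* x)) := :- (x :^ 5)) refl x)
                    (solve 1 (λ x → (x :* x) :* (x :* x) :* ((:- x) :* (x :* x)) := :- (x :^ 7)) refl x))
            (trans (*-congˡ (Θ-cong (solve 1 (λ x → let p = (:- x) :* (x :* x) in (:- x) :* (:- x) :* (p :* p :* p) := :- (x :^ 11)) refl x) refl))
                   (solve 2 (λ x y → (:- x) :* y := :- (x :* y)) refl x (G x))))

  G-product : ∀ {x} → Nil x → G x ≈ Q (x ^ 12) (x ^ 12) * Q (x ^ 11) (x ^ 12) * Q (x ^ 1) (x ^ 12)
  G-product {x} nil = trans (sym (jacobi-triple (- (x ^ 11)) (- x) (Nil-neg nil)))
    (*-cong (*-cong (Q-cong p p) (Q-cong (solve 1 (λ x → :- (:- (x :^ 11)) := x :^ 11) refl x) p))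
            (Q-cong (solve 1 (λ x → :- (:- x) := x :^ 1) refl x) p))
    where
    p : (- (x ^ 11)) * (- x) ≈ x ^ 12
    p = solve 1 (λ x → (:- (x :^ 11)) :* (:- x) := x :^ 12) refl x

  H-product : ∀ {x} → Nil x → H x ≈ Q (x ^ 12) (x ^ 12) * Q (x ^ 5) (x ^ 12) * Q (x ^ 7) (x ^ 12)
  H-product {x} nil = trans (sym (jacobi-triple (- (x ^ 5)) (- (x ^ 7)) (Nil-neg (Nil-*ʳ _ nil))))
    (*-cong (*-cong (Q-cong p p) (Q-cong (solve 1 (λ x → :- (:- (x :^ 5)) := x :^ 5) refl x) p))
            (Q-cong (solve 1 (λ x → :- (:- (x :^ 7)) := x :^ 7) refl x) p))
    where
    p : (- (x ^ 5)) * (- (x ^ 7)) ≈ x ^ 12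
    p = solve 1 (λ x → (:- (x :^ 5)) :* (:- (x :^ 7)) := x :^ 12) refl x

  φ-product : ∀ {x} → Nil x → φ x ≈ Q (x * x) (x * x) * Q (- x) (x * x) * Q (- x) (x * x)
  φ-product {x} nil = trans (sym (φ-theta x)) (sym (jacobi-triple x x nil))

  -- The triple product has base (-x)³ and as arguments the first three powers of -x, so it
  -- assembles to (-x;-x)∞: `A` is Euler's pentagonal series at -x. Splitting by parity of the
  -- exponent gives the stated form.
  A-product : ∀ {x} → Nil x → A x ≈ Q (- x) (x * x) * Q (x * x) (x * x)
  A-product {x} nil = begin
    A x
      ≈⟨ jacobi-triple x (- (x * x)) (Nil-neg (Nil-*ʳ x nil)) ⟨
    Q p p * Q (- x) p * Q (- (- (x * x))) p
      ≈⟨ *-cong (*-cong (Q-cong p≈₂ p≈) (Q-cong refl p≈)) (Q-cong (solve 1 (λ x → :- (:- (x :* x)) := (:- x) :* (:- x)) refl x) p≈) ⟩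
    Q ((- x) * ((- x) * (- x))) ((- x) ^ 3) * Q (- x) ((- x) ^ 3) * Q ((- x) * (- x)) ((- x) ^ 3)
      ≈⟨ solve 3 (λ a b c → c :* a :* b := a :* b :* c) refl _ _ _ ⟩
    Q (- x) ((- x) ^ 3) * Q ((- x) * (- x)) ((- x) ^ 3) * Q ((- x) * ((- x) * (- x))) ((- x) ^ 3)
      ≈⟨ Q-thirds (- x) (Nil-neg nil) ⟨
    Q (- x) (- x)
      ≈⟨ Q-halves (- x) (Nil-neg nil) ⟩
    Q (- x) ((- x) * (- x)) * Q ((- x) * (- x)) ((- x) * (- x))
      ≈⟨ *-cong (Q-cong refl xx) (Q-cong xx xx) ⟩
    Q (- x) (x * x) * Q (x * x) (x * x) ∎
    where
    p : Carrier
    p = x * (- (x * x))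
    p≈ : p ≈ (- x) ^ 3
    p≈ = solve 1 (λ x → x :* (:- (x :* x)) := (:- x) :^ 3) refl x
    p≈₂ : p ≈ (- x) * ((- x) * (- x))
    p≈₂ = solve 1 (λ x → x :* (:- (x :* x)) := (:- x) :* ((:- x) :* (:- x))) refl x
    xx : (- x) * (- x) ≈ x * x
    xx = solve 1 (λ x → (:- x) :* (:- x) := x :* x) refl x

  A-φ : ∀ {x} → Nil x → A x * Q (- x) (x * x) ≈ φ x
  A-φ {x} nil = trans (*-congʳ (A-product nil)) (trans
    (solve 2 (λ a b → a :* b :* a := b :* a :* a) refl _ _) (sym (φ-product nil)))

  -- Euler's identity (-x;x)∞ (x;x²)∞ = 1, restricted to exponents prime to 3. After multiplication
  -- by (x²;x⁶)∞ (x⁴;x⁶)∞ each signed factor pairs off to base x¹², where everything recombines to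
  -- that same multiplier.
  Q-mod-6 : ∀ {x} → Nil x →
    (Q (- (x ^ 1)) (x ^ 6) * Q (x ^ 1) (x ^ 6)) * (Q (- (x ^ 5)) (x ^ 6) * Q (x ^ 5) (x ^ 6)) *
    (Q (- (x ^ 2)) (x ^ 6) * Q (- (x ^ 4)) (x ^ 6)) ≈ 1#
  Q-mod-6 {x} nil = cancel (cancellable-* (cancellable-Q (x ^ 6) (Nil-*ʳ (x ^ 1) nil)) (cancellable-Q (x ^ 6) (Nil-*ʳ (x ^ 3) nil))) (begin
    (Q (x ^ 2) X * Q (x ^ 4) X) * ((m 1 * Q (x ^ 1) X) * (m 5 * Q (x ^ 5) X) * (m 2 * m 4))
      ≈⟨ solve 6 (λ a b c d e f → (a :* b) :* (c :* d :* (e :* f)) := c :* d :* ((e :* a) :* (f :* b))) refl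
           (Q (x ^ 2) X) (Q (x ^ 4) X) (m 1 * Q (x ^ 1) X) (m 5 * Q (x ^ 5) X) (m 2) (m 4) ⟩
    (m 1 * Q (x ^ 1) X) * (m 5 * Q (x ^ 5) X) * ((m 2 * Q (x ^ 2) X) * (m 4 * Q (x ^ 4) X))
      ≈⟨ *-cong (*-cong (square 1) (square 5)) (*-cong (square 2) (square 4)) ⟩
    (s 2 * s 10) * (s 4 * s 8)
      ≈⟨ solve 4 (λ a b c d → (a :* b) :* (c :* d) := (a :* d) :* (c :* b)) refl (s 2) (s 10) (s 4) (s 8) ⟩
    (s 2 * s 8) * (s 4 * s 10)
      ≈⟨ *-cong (halves 2) (halves 4) ⟨
    Q (x ^ 2) X * Q (x ^ 4) X
      ≈⟨ *-identityʳ _ ⟨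
    Q (x ^ 2) X * Q (x ^ 4) X * 1# ∎)
    where
    X = x ^ 6
    m s : ℕ → Carrier
    m i = Q (- (x ^ i)) X
    s i = Q (x ^ i) (X * X)
    square : ∀ i → m i * Q (x ^ i) X ≈ s (i ℕ.+ i)
    square i = trans (Q-square (x ^ i) X) (Q-cong (sym (^-homo-* x i i)) refl)
    halves : ∀ i → Q (x ^ i) X ≈ s i * s (i ℕ.+ 6)
    halves i = trans (Q-halves (x ^ i) (Nil-*ʳ _ nil)) (*-congˡ (Q-cong (sym (^-homo-* x i 6)) refl))

  -- Over the base x⁶ the left side consists of the product in `Q-mod-6`, which is 1, and of
  -- (x⁶;x⁶)∞ times the square of (-x³;x⁶)∞, the triple product for φ(x³).
  B-φ : ∀ {x} → Nil x → B x * Q (- x) (x * x) ≈ φ (x ^ 3)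
  B-φ {x} nil = begin
    B x * Q (- x) (x * x)
      ≈⟨ *-cong (sym (jacobi-triple (- x) (x * x) (Nil-*ʳ x nil))) (Q-thirds (- x) (Nil-*ʳ x nil)) ⟩
    (Q p p * Q (- (- x)) p * Q (- (x * x)) p) *
      (Q (- x) ((x * x) ^ 3) * Q (- x * (x * x)) ((x * x) ^ 3) * Q (- x * ((x * x) * (x * x))) ((x * x) ^ 3))
      ≈⟨ *-cong
           (*-cong (*-cong
             (halves (solve 1 (λ x → (:- x) :* (x :* x) := :- (x :^ 3)) refl x) (solve 1 (λ x → let p = (:- x) :* (x :* x) in p :* p := x :^ 6) refl x))
             (halves (solve 1 (λ x → :- (:- x) := x :^ 1) refl x) (solve 1 (λ x → let p = (:- x) :* (x :* x) in (:- (:- x)) :* p := :- (x :^ 4)) refl x)))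
             (halves (solve 1 (λ x → :- (x :* x) := :- (x :^ 2)) refl x) (solve 1 (λ x → let p = (:- x) :* (x :* x) in (:- (x :* x)) :* p := x :^ 5) refl x)))
           (*-cong (*-cong
             (Q-cong (solve 1 (λ x → :- x := :- (x :^ 1)) refl x) x⁶)
             (Q-cong (solve 1 (λ x → (:- x) :* (x :* x) := :- (x :^ 3)) refl x) x⁶))
             (Q-cong (solve 1 (λ x → (:- x) :* ((x :* x) :* (x :* x)) := :- (x :^ 5)) refl x) x⁶)) ⟩
    ((m 3 * s 6) * (s 1 * m 4) * (m 2 * s 5)) * (m 1 * m 3 * m 5)
      ≈⟨ solve 8 (λ m₃ s₆ s₁ m₄ m₂ s₅ m₁ m₅ → ((m₃ :* s₆) :* (s₁ :* m₄) :* (m₂ :* s₅)) :* (m₁ :* m₃ :* m₅)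
           := ((m₁ :* s₁) :* (m₅ :* s₅) :* (m₂ :* m₄)) :* (s₆ :* m₃ :* m₃)) refl (m 3) (s 6) (s 1) (m 4) (m 2) (s 5) (m 1) (m 5) ⟩
    ((m 1 * s 1) * (m 5 * s 5) * (m 2 * m 4)) * (s 6 * m 3 * m 3)
      ≈⟨ trans (*-congʳ (Q-mod-6 nil)) (*-identityˡ _) ⟩
    s 6 * m 3 * m 3
      ≈⟨ *-cong (*-cong (Q-cong x³x³ x³x³) (Q-cong refl x³x³)) (Q-cong refl x³x³) ⟩
    Q (x ^ 3 * x ^ 3) (x ^ 3 * x ^ 3) * Q (- (x ^ 3)) (x ^ 3 * x ^ 3) * Q (- (x ^ 3)) (x ^ 3 * x ^ 3)
      ≈⟨ φ-product (Nil-*ʳ _ nil) ⟨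
    φ (x ^ 3) ∎
    where
    p : Carrier
    p = - x * (x * x)
    m s : ℕ → Carrier
    m i = Q (- (x ^ i)) (x ^ 6)
    s i = Q (x ^ i) (x ^ 6)
    x⁶ : (x * x) ^ 3 ≈ x ^ 6
    x⁶ = solve 1 (λ x → (x :* x) :^ 3 := x :^ 6) refl x
    x³x³ : x ^ 6 ≈ x ^ 3 * x ^ 3
    x³x³ = ^-homo-* x 3 3
    halves : ∀ {y z w} → y ≈ z → y * p ≈ w → Q y p ≈ Q z (x ^ 6) * Q w (x ^ 6)
    halves {y} y≈z yp≈w = trans (Q-halves y (Nil-*ʳ (x * x) (Nil-neg nil))) (*-cong (Q-cong y≈z pp) (Q-cong yp≈w pp))
      where
      pp : p * p ≈ x ^ 6
      pp = solve 1 (λ x → let p = (:- x) :* (x :* x) in p :* p := x :^ 6) refl x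

  -- (3j + 1)² = 1 + 15j + 18 j(j-1)/2, and at j = -m this equals 1 + 3m + 18 m(m-1)/2.
  residueSum₁-theta : ∀ x → residueSum 1 x ≈ x * Θ (x ^ 15) (x ^ 3)
  residueSum₁-theta x = sym (trans (∑ℤ-*ˡ W x (term (x ^ 15) (x ^ 3))) (∑ℤ-cong W {λ j → x * term (x ^ 15) (x ^ 3) j} {third 1 x} term≈))
    where
    x¹⁸ : x ^ 15 * x ^ 3 ≈ x ^ 18
    x¹⁸ = sym (^-homo-* x 15 3)
    monomial : ∀ a i → x * u (x ^ 15 * x ^ 3) (x ^ a) i ≈ x ^ (1 ℕ.+ (a ℕ.* i ℕ.+ 18 ℕ.* triangle i))
    monomial a i = *-congˡ (trans (u-cong x¹⁸ refl i) (trans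
      (*-cong (^-assocʳ x a i) (^-assocʳ x 18 (triangle i))) (sym (^-homo-* x (a ℕ.* i) (18 ℕ.* triangle i)))))
    9i² : ∀ i → 9 ℕ.* (i ℕ.* i) ≡ 9 ℕ.* (i ℕ.+ (triangle i ℕ.+ triangle i))
    9i² i = ≡.cong (9 ℕ.*_) (≡.sym (triangle-square i))
    up : ∀ i → ∣ 3* + i + 1 ∣ ≡ 3 ℕ.* i ℕ.+ 1
    up i = ≡.cong (λ z → ∣ z ℤ.+ + 1 ∣) (≡.sym (ℤ.pos-* 3 i))
    down : ∀ i → ∣ 3* -[1+ i ] + 1 ∣ ≡ i ℕ.+ 2 ℕ.* suc i
    down i = ≡.trans (≡.cong ∣_∣ (≡.trans (ℤ.+-comm (+ 3 ℤ.* -[1+ i ]) (+ 1)) (suc-neg (i ℕ.+ 2 ℕ.* suc i)))) (ℤ.∣-i∣≡∣i∣ (+ (i ℕ.+ 2 ℕ.* suc i)))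
    up-exponent : ∀ i → 1 ℕ.+ (15 ℕ.* i ℕ.+ 18 ℕ.* triangle i) ≡ (3 ℕ.* i ℕ.+ 1) ℕ.* (3 ℕ.* i ℕ.+ 1)
    up-exponent i = ≡.trans
      (ℕS.solve 2 (λ i t → ℕS.con 1 ℕS.:+ (ℕS.con 15 ℕS.:* i ℕS.:+ ℕS.con 18 ℕS.:* t) ℕS.:= ℕS.con 9 ℕS.:* (i ℕS.:+ (t ℕS.:+ t)) ℕS.:+ (ℕS.con 6 ℕS.:* i ℕS.:+ ℕS.con 1)) ≡.refl i (triangle i))
      (≡.trans (≡.cong (ℕ._+ (6 ℕ.* i ℕ.+ 1)) (≡.sym (9i² i)))
      (ℕS.solve 1 (λ i → ℕS.con 9 ℕS.:* (i ℕS.:* i) ℕS.:+ (ℕS.con 6 ℕS.:* i ℕS.:+ ℕS.con 1) ℕS.:= (ℕS.con 3 ℕS.:* i ℕS.:+ ℕS.con 1) ℕS.:* (ℕS.con 3 ℕS.:* i ℕS.:+ ℕS.con 1)) ≡.refl i))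
    down-exponent : ∀ i → 1 ℕ.+ (3 ℕ.* suc i ℕ.+ 18 ℕ.* triangle (suc i)) ≡ (i ℕ.+ 2 ℕ.* suc i) ℕ.* (i ℕ.+ 2 ℕ.* suc i)
    down-exponent i = ≡.trans
      (ℕS.solve 2 (λ i t → ℕS.con 1 ℕS.:+ (ℕS.con 3 ℕS.:* (ℕS.con 1 ℕS.:+ i) ℕS.:+ ℕS.con 18 ℕS.:* (t ℕS.:+ i)) ℕS.:= ℕS.con 9 ℕS.:* (i ℕS.:+ (t ℕS.:+ t)) ℕS.:+ (ℕS.con 12 ℕS.:* i ℕS.:+ ℕS.con 4)) ≡.refl i (triangle i))
      (≡.trans (≡.cong (ℕ._+ (12 ℕ.* i ℕ.+ 4)) (≡.sym (9i² i)))
      (ℕS.solve 1 (λ i → ℕS.con 9 ℕS.:* (i ℕS.:* i) ℕS.:+ (ℕS.con 12 ℕS.:* i ℕS.:+ ℕS.con 4) ℕS.:= (i ℕS.:+ ℕS.con 2 ℕS.:* (ℕS.con 1 ℕS.:+ i)) ℕS.:* (i ℕS.:+ ℕS.con 2 ℕS.:* (ℕS.con 1 ℕS.:+ i))) ≡.refl i))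
    term≈ : ∀ j → x * term (x ^ 15) (x ^ 3) j ≈ third 1 x j
    term≈ (+ i)    = trans (monomial 15 i) (^-congʳ x (≡.trans (up-exponent i) (≡.cong (λ n → n ℕ.* n) (≡.sym (up i)))))
    term≈ -[1+ i ] = trans (monomial 3 (suc i)) (^-congʳ x (≡.trans (down-exponent i) (≡.cong (λ n → n ℕ.* n) (≡.sym (down i)))))

-- Infinite products as multisets of residues modulo 72

insert : ℕ → List ℕ → List ℕ
insert i []       = i ∷ []
insert i (j ∷ js) = if i ℕ.≤ᵇ j then i ∷ j ∷ js else j ∷ insert i js

sort : List ℕ → List ℕ
sort []       = []
sort (i ∷ is) = insert i (sort is)

progression : ℕ → ℕ → ℕ → List ℕ
progression r c d = applyUpTo (λ i → r ℕ.+ c ℕ.* i) d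

residues : (ℕ → Bool) → ℕ → List ℕ
residues χ d = map suc (filterᵇ χ (upTo d))

module Monomials {c ℓ} (R : CommutativeRing c ℓ) (g : ℕ → CommutativeRing.Carrier R) where
  open CommutativeRing R
  open BigOp *-commutativeMonoid renaming (⨁ to ∏)
  open IntegerSolver R

  mono : List ℕ → Carrier
  mono []       = 1#
  mono (i ∷ is) = g i * mono is

  mono-++ : ∀ is js → mono (is ++ js) ≈ mono is * mono js
  mono-++ []       js = sym (*-identityˡ _)
  mono-++ (i ∷ is) js = trans (*-congˡ (mono-++ is js)) (sym (*-assoc _ _ _))

  mono-insert : ∀ i is → mono (insert i is) ≈ g i * mono is
  mono-insert i []       = refl
  mono-insert i (j ∷ js) with i ℕ.≤ᵇ j
  ... | true  = refl
  ... | false = trans (*-congˡ (mono-insert i js)) (solve 3 (λ x y z → x :* (y :* z) := y :* (x :* z)) refl (g j) (g i) (mono js))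

  mono-sort : ∀ is → mono (sort is) ≈ mono is
  mono-sort []       = refl
  mono-sort (i ∷ is) = trans (mono-insert i (sort is)) (*-congˡ (mono-sort is))

  -- Reduces an identity between products to equality of two closed lists, which holds by
  -- evaluation.
  mono-≈ : ∀ is js → sort is ≡ sort js → mono is ≈ mono js
  mono-≈ is js eq = trans (sym (mono-sort is)) (trans (reflexive (≡.cong mono eq)) (mono-sort js))

  mono-applyUpTo : ∀ f n → mono (applyUpTo f n) ≈ ∏ n (g ∘ f)
  mono-applyUpTo f zero    = refl
  mono-applyUpTo f (suc n) = *-congˡ (mono-applyUpTo (f ∘ suc) n)

  mono-filter : ∀ χ f n → mono (map suc (filterᵇ χ (applyUpTo f n))) ≈ ∏ n (λ i → if χ (f i) then g (suc (f i)) else 1#)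
  mono-filter χ f zero = refl
  mono-filter χ f (suc n) with χ (f 0)
  ... | true  = *-congˡ (mono-filter χ (f ∘ suc) n)
  ... | false = trans (mono-filter χ (f ∘ suc) n) (sym (*-identityˡ _))

module Modulus {c ℓ} (R : CommutativeRing c ℓ) (N : ℕ) (q : CommutativeRing.Carrier R) (q-nil : Nilpotent.Nil R N q) where
  open Nilpotent R N
  open Monomials R (λ r → Q (q ^ r) (q ^ 72)) public
  open Relation.Binary.Reasoning.Setoid setoid

  q^-nil : ∀ r → Nil (q ^ suc r)
  q^-nil r = Nil-*ʳ (q ^ r) q-nil

  Q-mono : ∀ r c d → suc c ℕ.* suc d ≡ 72 → Q (q ^ r) (q ^ suc c) ≈ mono (progression r (suc c) (suc d))
  Q-mono r c d cd≡72 = begin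
    Q (q ^ r) (q ^ suc c)
      ≈⟨ Q-blocks d (q ^ r) (q^-nil c) ⟩
    ∏ (suc d) (λ i → Q (q ^ r * (q ^ suc c) ^ i) ((q ^ suc c) ^ suc d))
      ≈⟨ ∏-cong (suc d) {λ i → Q (q ^ r * (q ^ suc c) ^ i) ((q ^ suc c) ^ suc d)} {λ i → Q (q ^ (r ℕ.+ suc c ℕ.* i)) (q ^ 72)} (λ i → Q-cong
           (trans (*-congˡ (^-assocʳ q (suc c) i)) (sym (^-homo-* q r (suc c ℕ.* i))))
           (trans (^-assocʳ q (suc c) (suc d)) (^-congʳ q cd≡72))) ⟩
    ∏ (suc d) (λ i → Q (q ^ (r ℕ.+ suc c ℕ.* i)) (q ^ 72))
      ≈⟨ mono-applyUpTo (λ i → r ℕ.+ suc c ℕ.* i) (suc d) ⟨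
    mono (progression r (suc c) (suc d)) ∎

  Q-mono-^ : ∀ {r c} a x c′ d → a ℕ.* x ≡ r → a ℕ.* c′ ≡ suc c → suc c ℕ.* suc d ≡ 72 →
             Q ((q ^ a) ^ x) ((q ^ a) ^ c′) ≈ mono (progression r (suc c) (suc d))
  Q-mono-^ {r} {c} a x c′ d eq₁ eq₂ eq₃ = trans
    (Q-cong (trans (^-assocʳ q a x) (^-congʳ q eq₁)) (trans (^-assocʳ q a c′) (^-congʳ q eq₂)))
    (Q-mono r c d eq₃)

  factors : (ℕ → Bool) → ℕ → Carrier
  factors χ i = if χ i then 1# - q ^ suc i else 1#

  -- Among 72N factors each residue class receives N, exactly a full `Q (q ^ suc i) (q ^ 72)`.
  residues-product : ∀ χ → (∀ k i → χ (k ℕ.* 72 ℕ.+ i) ≡ χ i) →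
                     ∏ (N ℕ.* 72) (factors χ) ≈ mono (residues χ 72)
  residues-product χ periodic = begin
    ∏ (N ℕ.* 72) (factors χ)
      ≈⟨ ∏-blocks N 72 (factors χ) ⟩
    ∏ 72 (λ i → ∏ N (λ k → factors χ (k ℕ.* 72 ℕ.+ i)))
      ≈⟨ ∏-cong 72 {λ i → ∏ N (λ k → factors χ (k ℕ.* 72 ℕ.+ i))} {λ i → if χ i then Q (q ^ suc i) (q ^ 72) else 1#} class ⟩
    ∏ 72 (λ i → if χ i then Q (q ^ suc i) (q ^ 72) else 1#)
      ≈⟨ mono-filter χ (λ i → i) 72 ⟨
    mono (residues χ 72) ∎
    where
    exponent : ∀ i k → q ^ suc (k ℕ.* 72 ℕ.+ i) ≈ q ^ suc i * (q ^ 72) ^ k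
    exponent i k = begin
      q ^ suc (k ℕ.* 72 ℕ.+ i)       ≡⟨ ≡.cong (λ n → q ^ suc n) (≡.trans (ℕ.+-comm (k ℕ.* 72) i) (≡.cong (i ℕ.+_) (ℕ.*-comm k 72))) ⟩
      q ^ (suc i ℕ.+ 72 ℕ.* k)       ≈⟨ ^-homo-* q (suc i) (72 ℕ.* k) ⟩
      q ^ suc i * q ^ (72 ℕ.* k)     ≈⟨ *-congˡ (^-assocʳ q 72 k) ⟨
      q ^ suc i * (q ^ 72) ^ k       ∎
    class : ∀ i → ∏ N (λ k → factors χ (k ℕ.* 72 ℕ.+ i)) ≈ (if χ i then Q (q ^ suc i) (q ^ 72) else 1#)
    class i with χ i in χi
    ... | true  = ∏-cong N (λ k → trans (reflexive (≡.cong (if_then 1# - q ^ suc (k ℕ.* 72 ℕ.+ i) else 1#) (≡.trans (periodic k i) χi))) (1-cong (exponent i k)))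
    ... | false = ∏-one N (λ k → reflexive (≡.cong (if_then 1# - q ^ suc (k ℕ.* 72 ℕ.+ i) else 1#) (≡.trans (periodic k i) χi)))

-- The product formula for D and the identity between the generating functions

module ShiftedIdentity {c ℓ} (R : CommutativeRing c ℓ) (N : ℕ) (q : CommutativeRing.Carrier R) (q-nil : Nilpotent.Nil R N q) where
  open Nilpotent R N
  open SquareSums R N
  open ThetaProducts R N
  open Modulus R N q q-nil
  open Relation.Binary.Reasoning.Setoid setoid

  q²-nil : Nil (q ^ 2)
  q²-nil = q^-nil 1
  q³-nil : Nil (q ^ 3)
  q³-nil = q^-nil 2

  D E Y₁ Y₂ Y₃ : Carrier
  D  = q ^ 2 * (G (q ^ 2) * H (q ^ 3)) - q ^ 3 * (H (q ^ 2) * G (q ^ 3))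
  E  = residueSum 1 (q ^ 2) * (residueSum 0 q - residueSum 1 q)
  Y₁ = Q (- (q ^ 2)) (q ^ 2 * q ^ 2)
  Y₂ = Q (- (q ^ 3)) (q ^ 3 * q ^ 3)
  Y₃ = Q (- q) (q * q)

  φ-cong : ∀ {x y} → x ≈ y → φ x ≈ φ y
  φ-cong x≈y = trans (sym (φ-theta _)) (trans (Θ-cong x≈y x≈y) (φ-theta _))
    where open EvenOdd R N using (Θ-cong)

  D-squares : (D + D) * (Y₁ * Y₂) ≈ E + E
  D-squares = begin
    (D + D) * (Y₁ * Y₂)
      -- The terms H H and G G cancel and each mixed term occurs twice, whence the factor 2.
      ≈⟨ *-congʳ (solve 6 (λ q₂ q₃ g₂ h₂ g₃ h₃ → let d = q₂ :* (g₂ :* h₃) :- q₃ :* (h₂ :* g₃) in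
           d :+ d := (h₂ :+ q₂ :* g₂) :* (h₃ :- q₃ :* g₃) :- (h₂ :- q₂ :* g₂) :* (h₃ :+ q₃ :* g₃)) refl
           (q ^ 2) (q ^ 3) (G (q ^ 2)) (H (q ^ 2)) (G (q ^ 3)) (H (q ^ 3))) ⟩
    ((H (q ^ 2) + q ^ 2 * G (q ^ 2)) * (H (q ^ 3) - q ^ 3 * G (q ^ 3))
      - (H (q ^ 2) - q ^ 2 * G (q ^ 2)) * (H (q ^ 3) + q ^ 3 * G (q ^ 3))) * (Y₁ * Y₂)
      ≈⟨ *-congʳ (+-cong (*-cong (A≈H+xG q²-nil) (B≈H-xG q³-nil)) (-‿cong (*-cong (B≈H-xG q²-nil) (A≈H+xG q³-nil)))) ⟨
    (A (q ^ 2) * B (q ^ 3) - B (q ^ 2) * A (q ^ 3)) * (Y₁ * Y₂)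
      ≈⟨ solve 6 (λ a₂ b₃ b₂ a₃ y₁ y₂ → (a₂ :* b₃ :- b₂ :* a₃) :* (y₁ :* y₂) := (a₂ :* y₁) :* (b₃ :* y₂) :- (b₂ :* y₁) :* (a₃ :* y₂)) refl
           (A (q ^ 2)) (B (q ^ 3)) (B (q ^ 2)) (A (q ^ 3)) Y₁ Y₂ ⟩
    (A (q ^ 2) * Y₁) * (B (q ^ 3) * Y₂) - (B (q ^ 2) * Y₁) * (A (q ^ 3) * Y₂)
      ≈⟨ +-cong (*-cong (A-φ q²-nil) (B-φ q³-nil)) (-‿cong (*-cong (B-φ q²-nil) (A-φ q³-nil))) ⟩
    φ (q ^ 2) * φ ((q ^ 3) ^ 3) - φ ((q ^ 2) ^ 3) * φ (q ^ 3)
      ≈⟨ +-cong (*-cong (φ-thirds q²-nil) (trans (φ-cong (^-assocʳ q 3 3)) (sym (residueSum₀≈φ q))))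
                (-‿cong (trans (*-congʳ (φ-cong (^-assocʳ q 2 3))) (trans (*-comm _ _) (φ-lattice q-nil)))) ⟩
    (residueSum 0 (q ^ 2) + (residueSum 1 (q ^ 2) + residueSum 1 (q ^ 2))) * residueSum 0 q
      - (residueSum 0 (q ^ 2) * residueSum 0 q + (residueSum 1 (q ^ 2) * residueSum 1 q + residueSum 1 (q ^ 2) * residueSum 1 q))
      -- The class 0 parts of the two products agree and cancel; the class 1 sum at q² is then a
      -- common factor.
      ≈⟨ solve 4 (λ c d a b → (c :+ (d :+ d)) :* a :- (c :* a :+ (d :* b :+ d :* b)) := d :* (a :- b) :+ d :* (a :- b)) refl
           (residueSum 0 (q ^ 2)) (residueSum 1 (q ^ 2)) (residueSum 0 q) (residueSum 1 q) ⟩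
    E + E ∎

  module _ (ω : Carrier) (1+ω+ω² : 1# + (ω + ω * ω) ≈ 0#) where
    open CubeRoot ω 1+ω+ω²

    ϑ : Carrier
    ϑ = Θ ((q ^ 2) ^ 15) ((q ^ 2) ^ 3)

    -- `Y₃` supplies the cube root 1 missing from the theta product with ω and ω². The completed
    -- product is (-q³;q⁶)∞ = `Y₂`, the very factor that `D-squares` put beside D, so it can be
    -- cancelled in `D-theta`.
    difference-product : (residueSum 0 q - residueSum 1 q) * Y₃ ≈ Q (q * q) (q * q) * Y₂
    difference-product = begin
      (residueSum 0 q - residueSum 1 q) * Y₃
        ≈⟨ *-congʳ (trans (sym (θ-ω q-nil)) (sym (jacobi-triple (ω * q) ((ω * ω) * q) (Nil-*ˡ (ω * ω) q-nil)))) ⟩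
      (Q p p * Q (- (ω * q)) p * Q (- ((ω * ω) * q)) p) * Y₃
        ≈⟨ *-congʳ (*-cong (*-cong (Q-cong p≈ p≈) (Q-cong refl p≈)) (Q-cong refl p≈)) ⟩
      (Q (q * q) (q * q) * Q (- (ω * q)) (q * q) * Q (- ((ω * ω) * q)) (q * q)) * Y₃
        ≈⟨ solve 4 (λ a b c d → (a :* b :* c) :* d := a :* (b :* c :* d)) refl _ _ _ _ ⟩
      Q (q * q) (q * q) * (Q (- (ω * q)) (q * q) * Q (- ((ω * ω) * q)) (q * q) * Y₃)
        ≈⟨ *-congˡ (trans (Q-cube q (q * q)) (Q-cong
             (solve 1 (λ q → :- (q :* (q :* q)) := :- (q :^ 3)) refl q)
             (solve 1 (λ q → (q :* q) :* ((q :* q) :* (q :* q)) := q :^ 3 :* q :^ 3) refl q))) ⟩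
      Q (q * q) (q * q) * Y₂ ∎
      where
      p : Carrier
      p = (ω * q) * ((ω * ω) * q)
      p≈ : p ≈ q * q
      p≈ = trans (solve 2 (λ w x → (w :* x) :* ((w :* w) :* x) := (w :* (w :* w)) :* (x :* x)) refl ω q)
                 (trans (*-congʳ ω³) (*-identityˡ _))

    D-theta : (D + D) * (Y₁ * Y₃) ≈ (q ^ 2 + q ^ 2) * (ϑ * Q (q * q) (q * q))
    D-theta = cancel (cancellable-Q (q ^ 3 * q ^ 3) (Nil-neg q³-nil)) (begin
      Y₂ * ((D + D) * (Y₁ * Y₃))
        ≈⟨ solve 4 (λ d y₁ y₂ y₃ → y₂ :* (d :* (y₁ :* y₃)) := (d :* (y₁ :* y₂)) :* y₃) refl (D + D) Y₁ Y₂ Y₃ ⟩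
      ((D + D) * (Y₁ * Y₂)) * Y₃
        ≈⟨ *-congʳ D-squares ⟩
      (E + E) * Y₃
        ≈⟨ solve 3 (λ a b y → (a :* b :+ a :* b) :* y := a :* (b :* y) :+ a :* (b :* y)) refl (residueSum 1 (q ^ 2)) (residueSum 0 q - residueSum 1 q) Y₃ ⟩
      residueSum 1 (q ^ 2) * ((residueSum 0 q - residueSum 1 q) * Y₃) + residueSum 1 (q ^ 2) * ((residueSum 0 q - residueSum 1 q) * Y₃)
        ≈⟨ +-cong half half ⟩
      (q ^ 2 * ϑ) * (Q (q * q) (q * q) * Y₂) + (q ^ 2 * ϑ) * (Q (q * q) (q * q) * Y₂)
        ≈⟨ solve 4 (λ q t r y → (q :* t) :* (r :* y) :+ (q :* t) :* (r :* y) := y :* ((q :+ q) :* (t :* r))) refl (q ^ 2) ϑ (Q (q * q) (q * q)) Y₂ ⟩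
      Y₂ * ((q ^ 2 + q ^ 2) * (ϑ * Q (q * q) (q * q))) ∎)
      where
      half : residueSum 1 (q ^ 2) * ((residueSum 0 q - residueSum 1 q) * Y₃) ≈ (q ^ 2 * ϑ) * (Q (q * q) (q * q) * Y₂)
      half = *-cong (residueSum₁-theta (q ^ 2)) difference-product

    -- Exponents of G(q²) H(q³), of H(q²) G(q³), and of the two sides of the sign-free formula for
    -- 2D. All representatives lie between 1 and 72, as they do in `residues`.
    positive-part negative-part left right : List ℕ
    positive-part = (progression 24 24 3 ++ progression 22 24 3 ++ progression 2 24 3)
                 ++ (progression 36 36 2 ++ progression 15 36 2 ++ progression 21 36 2)
    negative-part = (progression 24 24 3 ++ progression 10 24 3 ++ progression 14 24 3)
                 ++ (progression 36 36 2 ++ progression 33 36 2 ++ progression 3 36 2)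
    left  = progression 4 8 9 ++ progression 2 4 18 ++ progression 30 36 2 ++ progression 6 36 2
    right = progression 36 36 2 ++ progression 60 72 1 ++ progression 12 72 1
         ++ progression 2 2 36 ++ progression 2 4 18 ++ progression 1 2 36

    mono-++₂ : ∀ {x y} is js → x ≈ mono is → y ≈ mono js → x * y ≈ mono (is ++ js)
    mono-++₂ is js x≈ y≈ = trans (*-cong x≈ y≈) (sym (mono-++ is js))

    mono-++₃ : ∀ {x y z} is js ks → x ≈ mono is → y ≈ mono js → z ≈ mono ks → x * y * z ≈ mono (is ++ js ++ ks)
    mono-++₃ is js ks x≈ y≈ z≈ = trans (*-assoc _ _ _) (mono-++₂ is (js ++ ks) x≈ (mono-++₂ js ks y≈ z≈))

    GH-mono : G (q ^ 2) * H (q ^ 3) ≈ mono positive-part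
    GH-mono = mono-++₂ (progression 24 24 3 ++ progression 22 24 3 ++ progression 2 24 3) (progression 36 36 2 ++ progression 15 36 2 ++ progression 21 36 2)
      (trans (G-product q²-nil) (mono-++₃ (progression 24 24 3) (progression 22 24 3) (progression 2 24 3)
        (Q-mono-^ 2 12 12 2 ≡.refl ≡.refl ≡.refl) (Q-mono-^ 2 11 12 2 ≡.refl ≡.refl ≡.refl) (Q-mono-^ 2 1 12 2 ≡.refl ≡.refl ≡.refl)))
      (trans (H-product q³-nil) (mono-++₃ (progression 36 36 2) (progression 15 36 2) (progression 21 36 2)
        (Q-mono-^ 3 12 12 1 ≡.refl ≡.refl ≡.refl) (Q-mono-^ 3 5 12 1 ≡.refl ≡.refl ≡.refl) (Q-mono-^ 3 7 12 1 ≡.refl ≡.refl ≡.refl)))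

    HG-mono : H (q ^ 2) * G (q ^ 3) ≈ mono negative-part
    HG-mono = mono-++₂ (progression 24 24 3 ++ progression 10 24 3 ++ progression 14 24 3) (progression 36 36 2 ++ progression 33 36 2 ++ progression 3 36 2)
      (trans (H-product q²-nil) (mono-++₃ (progression 24 24 3) (progression 10 24 3) (progression 14 24 3)
        (Q-mono-^ 2 12 12 2 ≡.refl ≡.refl ≡.refl) (Q-mono-^ 2 5 12 2 ≡.refl ≡.refl ≡.refl) (Q-mono-^ 2 7 12 2 ≡.refl ≡.refl ≡.refl)))
      (trans (G-product q³-nil) (mono-++₃ (progression 36 36 2) (progression 33 36 2) (progression 3 36 2)
        (Q-mono-^ 3 12 12 1 ≡.refl ≡.refl ≡.refl) (Q-mono-^ 3 11 12 1 ≡.refl ≡.refl ≡.refl) (Q-mono-^ 3 1 12 1 ≡.refl ≡.refl ≡.refl)))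

    rightQ : Carrier
    rightQ = Q (q ^ 36) (q ^ 36) * (Q (q ^ 60) (q ^ 72) * (Q (q ^ 12) (q ^ 72) * (Q (q ^ 2) (q ^ 2) * (Q (q ^ 2) (q ^ 4) * Q (q ^ 1) (q ^ 2)))))

    rightQ-mono : rightQ ≈ mono right
    rightQ-mono =
      mono-++₂ (progression 36 36 2) (progression 60 72 1 ++ progression 12 72 1 ++ progression 2 2 36 ++ progression 2 4 18 ++ progression 1 2 36) (Q-mono 36 35 1 ≡.refl) (
      mono-++₂ (progression 60 72 1) (progression 12 72 1 ++ progression 2 2 36 ++ progression 2 4 18 ++ progression 1 2 36) (Q-mono 60 71 0 ≡.refl) (
      mono-++₂ (progression 12 72 1) (progression 2 2 36 ++ progression 2 4 18 ++ progression 1 2 36) (Q-mono 12 71 0 ≡.refl) (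
      mono-++₂ (progression 2 2 36) (progression 2 4 18 ++ progression 1 2 36) (Q-mono 2 1 35 ≡.refl) (
      mono-++₂ (progression 2 4 18) (progression 1 2 36) (Q-mono 2 3 17 ≡.refl) (Q-mono 1 1 35 ≡.refl)))))

    rightQ-cancellable : Cancellable rightQ
    rightQ-cancellable = cancellable-* (cQ 35) (cancellable-* (cQ 59) (cancellable-* (cQ 11) (cancellable-* (cQ 1) (cancellable-* (cQ 1) (cQ 0)))))
      where
      cQ : ∀ r {p} → Cancellable (Q (q ^ suc r) p)
      cQ r {p} = cancellable-Q p (q^-nil r)

    -- `D-theta` multiplied on both sides by the companions `Z₁`, `Z₃`, `Q a p`, `Q b p`. They turn
    -- `Y₁` and `Y₃` on the left, and the two signed factors of the triple product for ϑ on the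
    -- right, into products without signs.
    D-monomial : (D + D) * mono left ≈ (q ^ 2 + q ^ 2) * rightQ
    D-monomial = begin
      (D + D) * mono left
        ≈⟨ *-congˡ left-mono ⟨
      (D + D) * ((Y₁ * Z₁) * ((Y₃ * Z₃) * (Q a p * Q b p)))
        ≈⟨ solve 7 (λ d y₁ z₁ y₃ z₃ za zb → d :* ((y₁ :* z₁) :* ((y₃ :* z₃) :* (za :* zb))) := (d :* (y₁ :* y₃)) :* (z₁ :* z₃ :* (za :* zb))) refl
             (D + D) Y₁ Z₁ Y₃ Z₃ (Q a p) (Q b p) ⟩
      ((D + D) * (Y₁ * Y₃)) * (Z₁ * Z₃ * (Q a p * Q b p))
        ≈⟨ *-congʳ (trans D-theta (*-congˡ (*-congʳ (sym (jacobi-triple a b (Nil-*ʳ _ q²-nil)))))) ⟩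
      ((q ^ 2 + q ^ 2) * ((Q p p * Q (- a) p * Q (- b) p) * Q (q * q) (q * q))) * (Z₁ * Z₃ * (Q a p * Q b p))
        ≈⟨ solve 9 (λ q₂ pp ma mb qq z₁ z₃ za zb →
             (q₂ :* ((pp :* ma :* mb) :* qq)) :* (z₁ :* z₃ :* (za :* zb))
               := q₂ :* (pp :* ((ma :* za) :* ((mb :* zb) :* (qq :* (z₁ :* z₃)))))) refl
             (q ^ 2 + q ^ 2) (Q p p) (Q (- a) p) (Q (- b) p) (Q (q * q) (q * q)) Z₁ Z₃ (Q a p) (Q b p) ⟩
      (q ^ 2 + q ^ 2) * (Q p p * ((Q (- a) p * Q a p) * ((Q (- b) p * Q b p) * (Q (q * q) (q * q) * (Z₁ * Z₃)))))
        ≈⟨ *-congˡ (*-cong (Q-cong p≈ p≈) (*-cong (trans (Q-square a p) (Q-cong aa pp)) (*-cong (trans (Q-square b p) (Q-cong bb pp))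
             (*-cong (Q-cong qq qq) (*-cong (Q-cong refl q⁴) (Q-cong (sym (*-identityʳ q)) qq)))))) ⟩
      (q ^ 2 + q ^ 2) * rightQ ∎
      where
      a = (q ^ 2) ^ 15
      b = (q ^ 2) ^ 3
      p : Carrier
      p = a * b
      Z₁ = Q (q ^ 2) (q ^ 2 * q ^ 2)
      Z₃ = Q q (q * q)
      qq : q * q ≈ q ^ 2
      qq = *-congˡ (sym (*-identityʳ q))
      q⁴ : q ^ 2 * q ^ 2 ≈ q ^ 4
      q⁴ = sym (^-homo-* q 2 2)
      a≈ : a ≈ q ^ 30
      a≈ = ^-assocʳ q 2 15
      b≈ : b ≈ q ^ 6
      b≈ = ^-assocʳ q 2 3
      p≈ : p ≈ q ^ 36
      p≈ = trans (*-cong a≈ b≈) (sym (^-homo-* q 30 6))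
      aa : a * a ≈ q ^ 60
      aa = trans (*-cong a≈ a≈) (sym (^-homo-* q 30 30))
      bb : b * b ≈ q ^ 12
      bb = trans (*-cong b≈ b≈) (sym (^-homo-* q 6 6))
      pp : p * p ≈ q ^ 72
      pp = trans (*-cong p≈ p≈) (sym (^-homo-* q 36 36))
      left-mono : (Y₁ * Z₁) * ((Y₃ * Z₃) * (Q a p * Q b p)) ≈ mono left
      left-mono = mono-++₂ (progression 4 8 9) (progression 2 4 18 ++ progression 30 36 2 ++ progression 6 36 2)
        (trans (Q-square (q ^ 2) (q ^ 2 * q ^ 2)) (trans (Q-cong q⁴ (trans (*-cong q⁴ q⁴) (sym (^-homo-* q 4 4)))) (Q-mono 4 7 8 ≡.refl)))
        (mono-++₂ (progression 2 4 18) (progression 30 36 2 ++ progression 6 36 2)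
          (trans (Q-square q (q * q)) (trans (Q-cong qq (trans (*-cong qq qq) q⁴)) (Q-mono 2 3 17 ≡.refl)))
          (mono-++₂ (progression 30 36 2) (progression 6 36 2)
            (trans (Q-cong a≈ p≈) (Q-mono 30 35 1 ≡.refl))
            (trans (Q-cong b≈ p≈) (Q-mono 6 35 1 ≡.refl))))

    -- By the multiset identity x · `left` · `js` is `rightQ`, and C inverts the product over `js`.
    -- This turns a theta product into a generating function without dividing.
    inverse-mono : ∀ {x} is js C → x ≈ mono is → sort (is ++ left ++ js) ≡ sort right →
                   mono js * C ≈ 1# → x * mono left ≈ rightQ * C
    inverse-mono {x} is js C x≈ sorted inv = begin
      x * mono left
        ≈⟨ *-identityʳ _ ⟨
      x * mono left * 1#
        ≈⟨ *-congˡ inv ⟨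
      x * mono left * (mono js * C)
        ≈⟨ *-assoc _ _ _ ⟨
      x * mono left * mono js * C
        ≈⟨ *-congʳ (mono-++₃ is left js x≈ refl refl) ⟩
      mono (is ++ left ++ js) * C
        ≈⟨ *-congʳ (trans (mono-≈ (is ++ left ++ js) right sorted) (sym rightQ-mono)) ⟩
      rightQ * C ∎

    S₊ T₊ : ℕ → Bool
    S₊ i = S (suc i)
    T₊ i = T' (suc i)

    -- D times `left` is `rightQ` (q² C_S - q³ C_T), while its double is 2q² `rightQ` by
    -- `D-monomial`. The factor `rightQ` is cancellable; 2q² has to stay.
    shifted-identity : ∀ {C_S C_T} → mono (residues S₊ 72) * C_S ≈ 1# → mono (residues T₊ 72) * C_T ≈ 1# →
                       (q ^ 2 + q ^ 2) * C_S ≈ (q ^ 2 + q ^ 2) * (1# + q * C_T)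
    shifted-identity {C_S} {C_T} S-inv T-inv = cancel rightQ-cancellable (begin
      rightQ * ((q ^ 2 + q ^ 2) * C_S)
        ≈⟨ solve 4 (λ r q s t → let q₂ = q :^ 2 ; d = q₂ :* (r :* s) :- (q :^ 3) :* (r :* t) in
             r :* ((q₂ :+ q₂) :* s) := (d :+ d) :+ (q₂ :+ q₂) :* r :* (q :* t)) refl rightQ q C_S C_T ⟩
      (D′ + D′) + (q ^ 2 + q ^ 2) * rightQ * (q * C_T)
        ≈⟨ +-congʳ D′≈ ⟩
      (q ^ 2 + q ^ 2) * rightQ + (q ^ 2 + q ^ 2) * rightQ * (q * C_T)
        ≈⟨ solve 3 (λ r q t → q :* r :+ q :* r :* t := r :* (q :* (:1 :+ t))) refl rightQ (q ^ 2 + q ^ 2) (q * C_T) ⟩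
      rightQ * ((q ^ 2 + q ^ 2) * (1# + q * C_T)) ∎)
      where
      D′ : Carrier
      D′ = q ^ 2 * (rightQ * C_S) - q ^ 3 * (rightQ * C_T)
      D′≈ : D′ + D′ ≈ (q ^ 2 + q ^ 2) * rightQ
      D′≈ = begin
        D′ + D′
          ≈⟨ +-cong part part ⟩
        D * mono left + D * mono left
          ≈⟨ distribʳ _ _ _ ⟨
        (D + D) * mono left
          ≈⟨ D-monomial ⟩
        (q ^ 2 + q ^ 2) * rightQ ∎
        where
        part : D′ ≈ D * mono left
        part = trans
          -- Here the definitions of `S` and `T'` enter: each `≡.refl` compares two sorted lists of
          -- 94 residues.
          (+-cong (*-congˡ (sym (inverse-mono positive-part (residues S₊ 72) C_S GH-mono ≡.refl S-inv)))
                  (-‿cong (*-congˡ (sym (inverse-mono negative-part (residues T₊ 72) C_T HG-mono ≡.refl T-inv)))))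
          (solve 5 (λ a x b y l → a :* (x :* l) :- b :* (y :* l) := (a :* x :- b :* y) :* l) refl
            (q ^ 2) (G (q ^ 2) * H (q ^ 3)) (q ^ 3) (H (q ^ 2) * G (q ^ 3)) (mono left))

-- The coefficient ring ℤ[ω] and truncated power series over it

module Eisenstein where
  _⊞_ _⊠_ : ℤ × ℤ → ℤ × ℤ → ℤ × ℤ
  (a , b) ⊞ (c , d) = a ℤ.+ c , b ℤ.+ d
  (a , b) ⊠ (c , d) = a ℤ.* c ℤ.- b ℤ.* d , a ℤ.* d ℤ.+ b ℤ.* c ℤ.- b ℤ.* d

  ⊟_ : ℤ × ℤ → ℤ × ℤ
  ⊟ (a , b) = ℤ.- a , ℤ.- b

  -- (a , b) stands for a + bω with ω² + ω + 1 = 0.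
  ring : CommutativeRing _ _
  ring = record
    { Carrier = ℤ × ℤ
    ; _≈_ = _≡_
    ; _+_ = _⊞_
    ; _*_ = _⊠_
    ; -_  = ⊟_
    ; 0#  = + 0 , + 0
    ; 1#  = + 1 , + 0
    ; isCommutativeRing = record
      { isRing = record
        { +-isAbelianGroup = record
          { isGroup = record
            { isMonoid = record
              { isSemigroup = record
                { isMagma = record { isEquivalence = ≡.isEquivalence ; ∙-cong = ≡.cong₂ _⊞_ }
                ; assoc = λ (a , b) (c , d) (e , f) → ≡.cong₂ _,_ (ℤ.+-assoc a c e) (ℤ.+-assoc b d f)
                }
              ; identity = (λ (a , b) → ≡.cong₂ _,_ (ℤ.+-identityˡ a) (ℤ.+-identityˡ b))
                         , (λ (a , b) → ≡.cong₂ _,_ (ℤ.+-identityʳ a) (ℤ.+-identityʳ b))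
              }
            ; inverse = (λ (a , b) → ≡.cong₂ _,_ (ℤ.+-inverseˡ a) (ℤ.+-inverseˡ b))
                      , (λ (a , b) → ≡.cong₂ _,_ (ℤ.+-inverseʳ a) (ℤ.+-inverseʳ b))
            ; ⁻¹-cong = ≡.cong ⊟_
            }
          ; comm = λ (a , b) (c , d) → ≡.cong₂ _,_ (ℤ.+-comm a c) (ℤ.+-comm b d)
          }
        ; *-cong = ≡.cong₂ _⊠_
        ; *-assoc = λ (a , b) (c , d) (e , f) → ≡.cong₂ _,_
            (solveℤ 6 (λ a b c d e f →
              (a ⊗ c ⊕ (⊖ (b ⊗ d))) ⊗ e ⊕ (⊖ ((a ⊗ d ⊕ b ⊗ c ⊕ (⊖ (b ⊗ d))) ⊗ f))
              ⊜ a ⊗ (c ⊗ e ⊕ (⊖ (d ⊗ f))) ⊕ (⊖ (b ⊗ (c ⊗ f ⊕ d ⊗ e ⊕ (⊖ (d ⊗ f)))))) ≡.refl a b c d e f)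
            (solveℤ 6 (λ a b c d e f →
              (a ⊗ c ⊕ (⊖ (b ⊗ d))) ⊗ f ⊕ (a ⊗ d ⊕ b ⊗ c ⊕ (⊖ (b ⊗ d))) ⊗ e ⊕ (⊖ ((a ⊗ d ⊕ b ⊗ c ⊕ (⊖ (b ⊗ d))) ⊗ f))
              ⊜ a ⊗ (c ⊗ f ⊕ d ⊗ e ⊕ (⊖ (d ⊗ f))) ⊕ b ⊗ (c ⊗ e ⊕ (⊖ (d ⊗ f))) ⊕ (⊖ (b ⊗ (c ⊗ f ⊕ d ⊗ e ⊕ (⊖ (d ⊗ f)))))) ≡.refl a b c d e f)
        ; *-identity =
            (λ (a , b) → ≡.cong₂ _,_
              (solveℤ 2 (λ a b → conℤ (+ 1) ⊗ a ⊕ (⊖ (conℤ (+ 0) ⊗ b)) ⊜ a) ≡.refl a b)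
              (solveℤ 2 (λ a b → conℤ (+ 1) ⊗ b ⊕ conℤ (+ 0) ⊗ a ⊕ (⊖ (conℤ (+ 0) ⊗ b)) ⊜ b) ≡.refl a b))
          , (λ (a , b) → ≡.cong₂ _,_
              (solveℤ 2 (λ a b → a ⊗ conℤ (+ 1) ⊕ (⊖ (b ⊗ conℤ (+ 0))) ⊜ a) ≡.refl a b)
              (solveℤ 2 (λ a b → a ⊗ conℤ (+ 0) ⊕ b ⊗ conℤ (+ 1) ⊕ (⊖ (b ⊗ conℤ (+ 0))) ⊜ b) ≡.refl a b))
        ; distrib =
            (λ (a , b) (c , d) (e , f) → ≡.cong₂ _,_
              (solveℤ 6 (λ a b c d e f → a ⊗ (c ⊕ e) ⊕ (⊖ (b ⊗ (d ⊕ f))) ⊜ (a ⊗ c ⊕ (⊖ (b ⊗ d))) ⊕ (a ⊗ e ⊕ (⊖ (b ⊗ f)))) ≡.refl a b c d e f)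
              (solveℤ 6 (λ a b c d e f → a ⊗ (d ⊕ f) ⊕ b ⊗ (c ⊕ e) ⊕ (⊖ (b ⊗ (d ⊕ f)))
                ⊜ (a ⊗ d ⊕ b ⊗ c ⊕ (⊖ (b ⊗ d))) ⊕ (a ⊗ f ⊕ b ⊗ e ⊕ (⊖ (b ⊗ f)))) ≡.refl a b c d e f))
          , (λ (a , b) (c , d) (e , f) → ≡.cong₂ _,_
              (solveℤ 6 (λ a b c d e f → (c ⊕ e) ⊗ a ⊕ (⊖ ((d ⊕ f) ⊗ b)) ⊜ (c ⊗ a ⊕ (⊖ (d ⊗ b))) ⊕ (e ⊗ a ⊕ (⊖ (f ⊗ b)))) ≡.refl a b c d e f)
              (solveℤ 6 (λ a b c d e f → (c ⊕ e) ⊗ b ⊕ (d ⊕ f) ⊗ a ⊕ (⊖ ((d ⊕ f) ⊗ b))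
                ⊜ (c ⊗ b ⊕ d ⊗ a ⊕ (⊖ (d ⊗ b))) ⊕ (e ⊗ b ⊕ f ⊗ a ⊕ (⊖ (f ⊗ b)))) ≡.refl a b c d e f))
        }
      ; *-comm = λ (a , b) (c , d) → ≡.cong₂ _,_
          (≡.cong₂ ℤ._-_ (ℤ.*-comm a c) (ℤ.*-comm b d))
          (solveℤ 4 (λ a b c d → a ⊗ d ⊕ b ⊗ c ⊕ (⊖ (b ⊗ d)) ⊜ c ⊗ b ⊕ d ⊗ a ⊕ (⊖ (d ⊗ b))) ≡.refl a b c d)
      }
    }

module PowerSeries {c ℓ} (C : CommutativeRing c ℓ) (N : ℕ) where
  open CommutativeRing C
  open IntegerSolver C
  open Relation.Binary.Reasoning.Setoid setoid

  infixl 7 _⊛_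
  _⊛_ : (ℕ → Carrier) → (ℕ → Carrier) → ℕ → Carrier
  (f ⊛ g) zero    = f 0 * g 0
  (f ⊛ g) (suc n) = f 0 * g (suc n) + ((f ∘ suc) ⊛ g) n

  δ : ℕ → ℕ → Carrier
  δ zero    zero    = 1#
  δ zero    (suc _) = 0#
  δ (suc k) zero    = 0#
  δ (suc k) (suc n) = δ k n

  ⊛-cong : ∀ n {f g h k} → (∀ i → i ≤ n → f i ≈ h i) → (∀ i → i ≤ n → g i ≈ k i) → (f ⊛ g) n ≈ (h ⊛ k) n
  ⊛-cong zero    f≈ g≈ = *-cong (f≈ 0 z≤n) (g≈ 0 z≤n)
  ⊛-cong (suc n) f≈ g≈ = +-cong (*-cong (f≈ 0 z≤n) (g≈ (suc n) ℕ.≤-refl))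
    (⊛-cong n (λ i i≤n → f≈ (suc i) (s≤s i≤n)) (λ i i≤n → g≈ i (ℕ.m≤n⇒m≤1+n i≤n)))

  ⊛-distribʳ : ∀ n h f g → ((λ i → f i + g i) ⊛ h) n ≈ (f ⊛ h) n + (g ⊛ h) n
  ⊛-distribʳ zero    h f g = distribʳ (h 0) (f 0) (g 0)
  ⊛-distribʳ (suc n) h f g = trans (+-cong (distribʳ (h (suc n)) (f 0) (g 0)) (⊛-distribʳ n h (f ∘ suc) (g ∘ suc)))
    (solve 4 (λ a b c d → (a :+ b) :+ (c :+ d) := (a :+ c) :+ (b :+ d)) refl _ _ _ _)

  ⊛-scale : ∀ n a f g → ((λ i → a * f i) ⊛ g) n ≈ a * (f ⊛ g) n
  ⊛-scale zero    a f g = *-assoc _ _ _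
  ⊛-scale (suc n) a f g = trans (+-cong (*-assoc _ _ _) (⊛-scale n a (f ∘ suc) g)) (sym (distribˡ _ _ _))

  -- The definition of `_⊛_` peels the left factor; peeling the right one instead yields
  -- commutativity by induction.
  ⊛-unfoldʳ : ∀ n f g → (f ⊛ g) (suc n) ≈ f (suc n) * g 0 + (f ⊛ (g ∘ suc)) n
  ⊛-unfoldʳ zero    f g = +-comm _ _
  ⊛-unfoldʳ (suc n) f g = trans (+-congˡ (⊛-unfoldʳ n (f ∘ suc) g))
    (solve 3 (λ a b c → a :+ (b :+ c) := b :+ (a :+ c)) refl _ _ _)

  ⊛-comm : ∀ n f g → (f ⊛ g) n ≈ (g ⊛ f) n
  ⊛-comm zero    f g = *-comm _ _
  ⊛-comm (suc n) f g = trans (+-cong (*-comm _ _) (⊛-comm n (f ∘ suc) g)) (sym (⊛-unfoldʳ n g f))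

  ⊛-assoc : ∀ n f g h → ((f ⊛ g) ⊛ h) n ≈ (f ⊛ (g ⊛ h)) n
  ⊛-assoc zero    f g h = *-assoc _ _ _
  ⊛-assoc (suc n) f g h = begin
    f 0 * g 0 * h (suc n) + ((λ i → f 0 * g (suc i) + ((f ∘ suc) ⊛ g) i) ⊛ h) n
      ≈⟨ +-congˡ (trans (⊛-distribʳ n h (λ i → f 0 * g (suc i)) ((f ∘ suc) ⊛ g))
                        (+-cong (⊛-scale n (f 0) (g ∘ suc) h) (⊛-assoc n (f ∘ suc) g h))) ⟩
    f 0 * g 0 * h (suc n) + (f 0 * ((g ∘ suc) ⊛ h) n + ((f ∘ suc) ⊛ (g ⊛ h)) n)
      ≈⟨ solve 5 (λ a b c d e → a :* b :* c :+ (a :* d :+ e) := a :* (b :* c :+ d) :+ e) refl _ _ _ _ _ ⟩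
    f 0 * (g 0 * h (suc n) + ((g ∘ suc) ⊛ h) n) + ((f ∘ suc) ⊛ (g ⊛ h)) n ∎

  zero-⊛ : ∀ n f → ((λ _ → 0#) ⊛ f) n ≈ 0#
  zero-⊛ zero    f = zeroˡ _
  zero-⊛ (suc n) f = trans (+-cong (zeroˡ _) (zero-⊛ n f)) (+-identityˡ _)

  δ-⊛ : ∀ k n f → (δ k ⊛ f) (k ℕ.+ n) ≈ f n
  δ-⊛ zero    zero    f = *-identityˡ _
  δ-⊛ zero    (suc n) f = trans (+-cong (*-identityˡ _) (zero-⊛ n f)) (+-identityʳ _)
  δ-⊛ (suc k) n       f = trans (+-cong (zeroˡ _) (δ-⊛ k n f)) (+-identityˡ _)

  δ-⊛-< : ∀ {k n} f → n < k → (δ k ⊛ f) n ≈ 0#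
  δ-⊛-< {suc k} {zero}  f _         = zeroˡ _
  δ-⊛-< {suc k} {suc n} f (s≤s n<k) = trans (+-cong (zeroˡ _) (δ-⊛-< f n<k)) (+-identityˡ _)

  infix 4 _≋_
  -- Reduction modulo q^N happens in the equality: series keep all their coefficients, and those
  -- from degree N on are ignored.
  _≋_ : (ℕ → Carrier) → (ℕ → Carrier) → Set ℓ
  f ≋ g = ∀ n → n < N → f n ≈ g n

  ⊛-congᴺ : ∀ {f g h k} → f ≋ h → g ≋ k → f ⊛ g ≋ h ⊛ k
  ⊛-congᴺ f≋h g≋k n n<N = ⊛-cong n (λ i i≤n → f≋h i (ℕ.≤-<-trans i≤n n<N)) (λ i i≤n → g≋k i (ℕ.≤-<-trans i≤n n<N))

  truncated : CommutativeRing c ℓ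
  truncated = record
    { Carrier = ℕ → Carrier
    ; _≈_ = _≋_
    ; _+_ = λ f g n → f n + g n
    ; _*_ = _⊛_
    ; -_  = λ f n → - f n
    ; 0#  = λ _ → 0#
    ; 1#  = δ 0
    ; isCommutativeRing = record
      { isRing = record
        { +-isAbelianGroup = record
          { isGroup = record
            { isMonoid = record
              { isSemigroup = record
                { isMagma = record
                  { isEquivalence = record
                    { refl = λ _ _ → refl ; sym = λ p n n<N → sym (p n n<N) ; trans = λ p q n n<N → trans (p n n<N) (q n n<N) }
                  ; ∙-cong = λ p q n n<N → +-cong (p n n<N) (q n n<N)
                  }
                ; assoc = λ f g h n _ → +-assoc (f n) (g n) (h n)
                }
              ; identity = (λ f n _ → +-identityˡ (f n)) , (λ f n _ → +-identityʳ (f n))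
              }
            ; inverse = (λ f n _ → -‿inverseˡ (f n)) , (λ f n _ → -‿inverseʳ (f n))
            ; ⁻¹-cong = λ p n n<N → -‿cong (p n n<N)
            }
          ; comm = λ f g n _ → +-comm (f n) (g n)
          }
        ; *-cong = ⊛-congᴺ
        ; *-assoc = λ f g h n _ → ⊛-assoc n f g h
        ; *-identity = (λ f n _ → δ-⊛ 0 n f) , (λ f n _ → trans (⊛-comm n f (δ 0)) (δ-⊛ 0 n f))
        ; distrib = (λ f g h n _ → trans (⊛-comm n f (λ i → g i + h i)) (trans (⊛-distribʳ n f g h) (+-cong (⊛-comm n g f) (⊛-comm n h f))))
                  , (λ f g h n _ → ⊛-distribʳ n f g h)
        }
      ; *-comm = λ f g n _ → ⊛-comm n f g
      }
    }

-- Recurrences for counting partitions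

<⇒<ᵇ≡true : ∀ {m n} → m < n → (m ℕ.<ᵇ n) ≡ true
<⇒<ᵇ≡true {zero}  {suc n} _         = ≡.refl
<⇒<ᵇ≡true {suc m} {suc n} (s≤s m<n) = <⇒<ᵇ≡true m<n

≥⇒<ᵇ≡false : ∀ {m n} → n ≤ m → (m ℕ.<ᵇ n) ≡ false
≥⇒<ᵇ≡false {m}     {zero}  _         = ≡.refl
≥⇒<ᵇ≡false {suc m} {suc n} (s≤s n≤m) = ≥⇒<ᵇ≡false n≤m

open Defs using (p)

module Counting (χ : ℕ → Bool) where
  open BigOp ℕ.+-0-commutativeMonoid renaming (⨁ to ∑; ⨁-cong to ∑-cong; ⨁-ε to ∑-zero)

  count : List (List ℕ) → ℕ
  count = length ∘ filter (λ λs → T? (all χ λs))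

  count-++ : ∀ xs ys → count (xs ++ ys) ≡ count xs ℕ.+ count ys
  count-++ xs ys = ≡.trans (≡.cong length (filter-++ (λ λs → T? (all χ λs)) xs ys)) (length-++ (filter (λ λs → T? (all χ λs)) xs))

  count-∷ : ∀ x xs → count (map (x ∷_) xs) ≡ (if χ x then count xs else 0)
  count-∷ x xs with χ x in χx
  count-∷ x []       | true  = ≡.refl
  count-∷ x []       | false = ≡.refl
  count-∷ x (l ∷ ls) | true  rewrite χx with all χ l
  ... | true  = ≡.cong suc (≡.trans (count-∷ x ls) (≡.cong (if_then count ls else 0) χx))
  ... | false = ≡.trans (count-∷ x ls) (≡.cong (if_then count ls else 0) χx)
  count-∷ x (l ∷ ls) | false rewrite χx = ≡.trans (count-∷ x ls) (≡.cong (if_then count ls else 0) χx)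

  count-concatMap : ∀ (F : ℕ → List (List ℕ)) (ψ : ℕ → Bool) f n →
    count (concatMap F (filter (λ j → T? (ψ j)) (applyUpTo f n))) ≡ ∑ n (λ i → if ψ (f i) then count (F (f i)) else 0)
  count-concatMap F ψ f zero    = ≡.refl
  count-concatMap F ψ f (suc n) with ψ (f 0)
  ... | true  = ≡.trans (count-++ (F (f 0)) _) (≡.cong (count (F (f 0)) ℕ.+_) (count-concatMap F ψ (f ∘ suc) n))
  ... | false = count-concatMap F ψ (f ∘ suc) n

  belowSum : ℕ → ℕ → (ℕ → ℕ) → ℕ
  belowSum n k w = ∑ n (λ j → if (j ℕ.<ᵇ k) ∧ (j ℕ.<ᵇ n) then w j else 0)

  belowSum-suc : ∀ n k w → belowSum n (suc k) w ≡ belowSum n k w ℕ.+ (if k ℕ.<ᵇ n then w k else 0)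
  belowSum-suc zero    k       w = ≡.refl
  belowSum-suc (suc n) zero    w = ≡.trans (ℕ.+-comm (w 0) _) (≡.cong (ℕ._+ w 0) (≡.trans (∑-zero n (λ _ → ≡.refl)) (≡.sym (∑-zero n (λ _ → ≡.refl)))))
  belowSum-suc (suc n) (suc k) w = ≡.trans (≡.cong (w 0 ℕ.+_) (belowSum-suc n k (w ∘ suc))) (≡.sym (ℕ.+-assoc (w 0) _ _))

  counted : ℕ → ℕ → ℕ → ℕ
  counted f k n = count (allParts f k n)

  largest : ℕ → ℕ → ℕ → ℕ
  largest f n j = if χ (suc j) then counted f (suc j) (n ℕ.∸ j) else 0

  counted-suc : ∀ f k n → counted (suc f) k (suc n) ≡ belowSum (suc n) k (largest f n)
  counted-suc f k n = ≡.trans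
    (count-concatMap (λ j → map (suc j ∷_) (allParts f (suc j) (n ℕ.∸ j))) (λ j → (suc j ℕ.≤ᵇ k) ∧ (suc j ℕ.≤ᵇ suc n)) (λ j → j) (suc n))
    (∑-cong (suc n) (λ j → ≡.cong (if (j ℕ.<ᵇ k) ∧ (j ℕ.<ᵇ suc n) then_else 0) (count-∷ (suc j) (allParts f (suc j) (n ℕ.∸ j)))))

  -- In `counted-suc` the inner count of n ∸ j inherits the fuel of n. Independence of the fuel
  -- identifies it with `bounded` at n ∸ j, which is what makes a recurrence possible.
  counted-fuel : ∀ f f′ k n → n ≤ f → n ≤ f′ → counted f k n ≡ counted f′ k n
  counted-fuel zero    zero     k zero    _ _ = ≡.refl
  counted-fuel zero    (suc f′) k zero    _ _ = ≡.refl
  counted-fuel (suc f) zero     k zero    _ _ = ≡.refl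
  counted-fuel (suc f) (suc f′) k zero    _ _ = ≡.refl
  counted-fuel (suc f) (suc f′) k (suc n) (s≤s n≤f) (s≤s n≤f′) = ≡.trans (counted-suc f k n) (≡.trans
    (∑-cong (suc n) (λ j → ≡.cong (if (j ℕ.<ᵇ k) ∧ (j ℕ.<ᵇ suc n) then_else 0) (≡.cong (if χ (suc j) then_else 0)
      (counted-fuel f f′ (suc j) (n ℕ.∸ j) (ℕ.≤-trans (ℕ.m∸n≤m n j) n≤f) (ℕ.≤-trans (ℕ.m∸n≤m n j) n≤f′)))))
    (≡.sym (counted-suc f′ k n)))

  bounded : ℕ → ℕ → ℕ
  bounded k n = counted n k n

  -- `allParts` branches on the largest part, whereas the product formula needs a step in the bound.
  -- Raising the bound to k + 1 adds only the summand j = k: the partitions containing k + 1, with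
  -- one copy of it removed.
  bounded-suc : ∀ k n → bounded (suc k) (suc n) ≡
    bounded k (suc n) ℕ.+ (if k ℕ.<ᵇ suc n then (if χ (suc k) then bounded (suc k) (n ℕ.∸ k) else 0) else 0)
  bounded-suc k n = ≡.trans (counted-suc n (suc k) n) (≡.trans (belowSum-suc (suc n) k (largest n n))
    (≡.cong₂ ℕ._+_ (≡.sym (counted-suc n k n)) (≡.cong (if k ℕ.<ᵇ suc n then_else 0) (≡.cong (if χ (suc k) then_else 0)
      (counted-fuel n (n ℕ.∸ k) (suc k) (n ℕ.∸ k) (ℕ.m∸n≤m n k) ℕ.≤-refl)))))

  bounded-zero : ∀ n → bounded 0 (suc n) ≡ 0
  bounded-zero n = ≡.trans (counted-suc n 0 n) (∑-zero (suc n) (λ _ → ≡.refl))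

  bounded-unused : ∀ k n → n ≤ k → bounded (suc k) n ≡ bounded k n
  bounded-unused k zero    _ = ≡.refl
  bounded-unused k (suc n) n<k = ≡.trans (bounded-suc k n) (≡.trans
    (≡.cong (λ b → bounded k (suc n) ℕ.+ (if b then (if χ (suc k) then bounded (suc k) (n ℕ.∸ k) else 0) else 0)) (≥⇒<ᵇ≡false n<k))
    (ℕ.+-identityʳ _))

  bounded-large : ∀ m n → bounded (m ℕ.+ n) n ≡ p χ n
  bounded-large zero    n = ≡.refl
  bounded-large (suc m) n = ≡.trans (bounded-unused (m ℕ.+ n) n (ℕ.m≤n+m n m)) (bounded-large m n)

-- Partition generating functions as inverses of products

module GeneratingFunctions (N : ℕ) where
  open PowerSeries Eisenstein.ring N using (δ; δ-⊛; δ-⊛-<; zero-⊛; truncated)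
  open Nilpotent truncated N

  q : Carrier
  q = δ 1

  q^≈δ : ∀ k → q ^ k ≈ δ k
  q^≈δ zero    = refl
  q^≈δ (suc k) = trans (*-congˡ (q^≈δ k)) shift
    where
    shift : q * δ k ≈ δ (suc k)
    shift zero    _ = δ-⊛-< {1} (δ k) (s≤s z≤n)
    shift (suc n) _ = δ-⊛ 1 n (δ k)

  q-nil : Nil q
  q-nil = mkNil (trans (q^≈δ N) (λ n n<N → δ-large n<N))
    where
    δ-large : ∀ {k n} → n < k → δ k n ≡ (+ 0 , + 0)
    δ-large {suc k} {zero}  _         = ≡.refl
    δ-large {suc k} {suc n} (s≤s n<k) = δ-large n<k

  open Modulus truncated N q q-nil using (factors; mono; residues-product)

  ω : Carrier
  ω zero    = + 0 , + 1
  ω (suc n) = + 0 , + 0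

  1+ω+ω² : 1# + (ω + ω * ω) ≈ 0#
  1+ω+ω² zero    _ = ≡.refl
  1+ω+ω² (suc n) _ = ≡.cong (λ x → (+ 0 , + 0) ⊞ ((+ 0 , + 0) ⊞ ((+ 0 , + 0) ⊞ x))) (zero-⊛ n ω)
    where open Eisenstein using (_⊞_)

  module _ (χ : ℕ → Bool) where
    open Counting χ

    χ₊ : ℕ → Bool
    χ₊ i = χ (suc i)

    partitionSeries : ℕ → Carrier
    partitionSeries k n = + bounded k n , + 0

    partitionSeries-zero : partitionSeries 0 ≈ 1#
    partitionSeries-zero zero    _ = ≡.refl
    partitionSeries-zero (suc n) _ = ≡.cong (λ m → + m , + 0) (bounded-zero n)

    partitionSeries-used : ∀ k → χ₊ k ≡ true →
      partitionSeries (suc k) ≈ partitionSeries k + q ^ suc k * partitionSeries (suc k)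
    partitionSeries-used k used = trans recurrence (+-congˡ {partitionSeries k} (*-congʳ {partitionSeries (suc k)} (sym (q^≈δ (suc k)))))
      where
      open Eisenstein using (_⊞_)
      recurrence : partitionSeries (suc k) ≈ partitionSeries k + δ (suc k) * partitionSeries (suc k)
      recurrence zero    _ = ≡.cong ((+ 1 , + 0) ⊞_) (≡.sym (δ-⊛-< {suc k} (partitionSeries (suc k)) (s≤s z≤n)))
      recurrence (suc n) _ with k ℕ.≤? n
      ... | yes k≤n = ≡.trans
        (≡.cong (λ m → + m , + 0) (≡.trans (bounded-suc k n) (≡.cong₂ (λ b b′ → bounded k (suc n) ℕ.+ (if b then (if b′ then bounded (suc k) (n ℕ.∸ k) else 0) else 0)) (<⇒<ᵇ≡true (s≤s k≤n)) used)))
        (≡.cong (partitionSeries k (suc n) ⊞_) (≡.sym (≡.trans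
          (≡.cong (λ i → (δ (suc k) * partitionSeries (suc k)) (suc i)) (≡.sym (ℕ.m+[n∸m]≡n k≤n)))
          (δ-⊛ (suc k) (n ℕ.∸ k) (partitionSeries (suc k))))))
      ... | no k≰n = ≡.trans
        (≡.cong (λ m → + m , + 0) (≡.trans (bounded-unused k (suc n) (ℕ.≰⇒> k≰n)) (≡.sym (ℕ.+-identityʳ _))))
        (≡.cong (partitionSeries k (suc n) ⊞_) (≡.sym (δ-⊛-< (partitionSeries (suc k)) (s≤s (ℕ.≰⇒> k≰n)))))

    partitionSeries-unused : ∀ k → χ₊ k ≡ false → partitionSeries (suc k) ≈ partitionSeries k
    partitionSeries-unused k unused zero    _ = ≡.refl
    partitionSeries-unused k unused (suc n) _ = ≡.cong (λ m → + m , + 0) (≡.trans (bounded-suc k n)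
      (≡.trans (≡.cong (bounded k (suc n) ℕ.+_) (absent (k ℕ.<ᵇ suc n))) (ℕ.+-identityʳ _)))
      where
      absent : ∀ b → (if b then (if χ₊ k then bounded (suc k) (n ℕ.∸ k) else 0) else 0) ≡ 0
      absent true  rewrite unused = ≡.refl
      absent false = ≡.refl

    -- The recurrence in the bound, solved for the smaller bound. Over all bounds below K these
    -- steps telescope to Euler's product for the generating function.
    factor-step : ∀ k → factors χ₊ k * partitionSeries (suc k) ≈ partitionSeries k
    factor-step k with χ₊ k in χk
    ... | true  = trans (solve 2 (λ x y → (:1 :- x) :* y := y :- x :* y) refl (q ^ suc k) (partitionSeries (suc k)))
                 (trans (+-congʳ (partitionSeries-used k χk)) (solve 2 (λ x y → (x :+ y) :- y := x) refl (partitionSeries k) (q ^ suc k * partitionSeries (suc k))))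
    ... | false = trans (*-identityˡ (partitionSeries (suc k))) (partitionSeries-unused k χk)

    factors-inverse : ∀ K → ∏ K (factors χ₊) * partitionSeries K ≈ 1#
    factors-inverse zero    = trans (*-identityˡ (partitionSeries 0)) partitionSeries-zero
    factors-inverse (suc K) = trans (*-congʳ (∏-last K (factors χ₊)))
      (trans (*-assoc (∏ K (factors χ₊)) (factors χ₊ K) (partitionSeries (suc K)))
      (trans (*-congˡ {∏ K (factors χ₊)} (factor-step K)) (factors-inverse K)))

    residues-inverse : (∀ k i → χ₊ (k ℕ.* 72 ℕ.+ i) ≡ χ₊ i) →
                       mono (residues χ₊ 72) * partitionSeries (N ℕ.* 72) ≈ 1#
    residues-inverse periodic = trans (*-congʳ (sym (residues-product χ₊ periodic))) (factors-inverse (N ℕ.* 72))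

    -- A bound of 72N ≥ n excludes no partition of n.
    partitionSeries-p : ∀ {n} → n ≤ N → partitionSeries (N ℕ.* 72) n ≡ (+ p χ n , + 0)
    partitionSeries-p {n} n≤N = ≡.cong (λ m → + m , + 0) (≡.trans
      (≡.cong (λ k → bounded k n) (≡.sym (ℕ.m∸n+n≡m (ℕ.≤-trans n≤N (ℕ.m≤m*n N 72)))))
      (bounded-large (N ℕ.* 72 ℕ.∸ n) n))

-- Periodicity of the two sets and comparison of coefficients

72-periodic : ∀ k i → suc (k ℕ.* 72 ℕ.+ i) ℕ.% 72 ≡ suc i ℕ.% 72
72-periodic k i = ≡.trans (≡.cong (λ m → suc m ℕ.% 72) (ℕ.+-comm (k ℕ.* 72) i)) (ℕ.[m+kn]%n≡m%n (suc i) k 72)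

S-periodic : ∀ k i → S (suc (k ℕ.* 72 ℕ.+ i)) ≡ S (suc i)
S-periodic k i rewrite 72-periodic k i = ≡.refl

T'-periodic : ∀ k i → T' (suc (k ℕ.* 72 ℕ.+ i)) ≡ T' (suc i)
T'-periodic k i rewrite 72-periodic k i = ≡.refl

-- Removes the factor 2 that comes from working with 2D.
double-injective : ∀ {m n} → m ℕ.+ m ≡ n ℕ.+ n → m ≡ n
double-injective {zero}  {zero}  _  = ≡.refl
double-injective {suc m} {suc n} eq = ≡.cong suc (double-injective
  (ℕ.suc-injective (≡.trans (≡.sym (ℕ.+-suc m m)) (≡.trans (ℕ.suc-injective eq) (ℕ.+-suc n n)))))

theorem18p2 : (n : ℕ) → p S (suc n) ≡ p T' n
theorem18p2 n = double-injective (ℤ.+-injective (≡.cong proj₁ coefficients))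
  where
  N : ℕ
  -- The factor q² raises degree n + 1 to n + 3, the last degree that survives truncation at n + 4.
  N = 4 ℕ.+ n
  open GeneratingFunctions N
  open PowerSeries Eisenstein.ring N using (δ; _⊛_; δ-⊛; truncated)
  open Nilpotent truncated N
  open ShiftedIdentity truncated N q q-nil using (shifted-identity)
  open Eisenstein using (_⊞_)

  C_S C_T : Carrier
  C_S = partitionSeries S (N ℕ.* 72)
  C_T = partitionSeries T' (N ℕ.* 72)

  doubled : q * (q * (C_S + C_S)) ≈ q * (q * ((1# + q * C_T) + (1# + q * C_T)))
  doubled = trans (spread C_S) (trans
    (shifted-identity ω 1+ω+ω² (residues-inverse S S-periodic) (residues-inverse T' T'-periodic))
    (sym (spread (1# + q * C_T))))
    where
    spread : ∀ x → q * (q * (x + x)) ≈ (q ^ 2 + q ^ 2) * x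
    spread = solve 2 (λ q x → q :* (q :* (x :+ x)) := (q :^ 2 :+ q :^ 2) :* x) refl q

  coefficient : ∀ f → (q * (q * f)) (3 ℕ.+ n) ≡ f (suc n)
  coefficient f = ≡.trans (δ-⊛ 1 (2 ℕ.+ n) (q * f)) (δ-⊛ 1 (suc n) f)

  coefficients : (+ (p S (suc n) ℕ.+ p S (suc n)) , + 0) ≡ (+ (p T' n ℕ.+ p T' n) , + 0)
  coefficients = begin
    (+ p S (suc n) , + 0) ⊞ (+ p S (suc n) , + 0)
      ≡⟨ ≡.cong (λ x → x ⊞ x) (partitionSeries-p S (s≤s (ℕ.m≤n+m n 3))) ⟨
    C_S (suc n) ⊞ C_S (suc n)
      ≡⟨ coefficient (C_S + C_S) ⟨
    (q * (q * (C_S + C_S))) (3 ℕ.+ n)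
      ≡⟨ doubled (3 ℕ.+ n) ℕ.≤-refl ⟩
    (q * (q * ((1# + q * C_T) + (1# + q * C_T)))) (3 ℕ.+ n)
      ≡⟨ coefficient ((1# + q * C_T) + (1# + q * C_T)) ⟩
    (1# + q * C_T) (suc n) ⊞ (1# + q * C_T) (suc n)
      -- The constant series 1 contributes 0 in the positive degree n + 1.
      ≡⟨ ≡.cong (λ x → ((+ 0 , + 0) ⊞ x) ⊞ ((+ 0 , + 0) ⊞ x)) (≡.trans (δ-⊛ 1 n C_T) (partitionSeries-p T' (ℕ.m≤n+m n 4))) ⟩
    (+ p T' n , + 0) ⊞ (+ p T' n , + 0) ∎
    where open ≡.≡-Reasoning
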